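{- Let $v$ be a vertex of a parity game. Player even can win the forward basic update game, the backward basic update game, the forward antagonistic update game, and the backward antagonistic update game (each) from $v$ if, and only if, she can win the parity game from $v$.
   Context: A parity game is a tuple $(V_e,V_o,E,C,\phi)$, where $V=V_e\cup V_o$ (disjoint union) is a finite set of vertices, $E\subseteq V\times V$ is such that every vertex has at least one outgoing edge, $C\subseteq\{1,2,3,\ldots\}$ is a finite set of colours and $\phi:V\to C$. A token moves along edges; at a vertex of $V_e$ player even chooses the successor, at a vertex of $V_o$ player odd does. An infinite play $v_0,v_1,\ldots$ is won by even iff $\limsup_i\phi(v_i)$ is even. A strategy of even is a map $\sigma:V^*V_e\to V$ choosing successors; even wins the parity game from $v$ if she has a strategy such that all plays from $v$ consistent with it are won by her. Witness sequences. Let $e=|\{v\in V:\phi(v)\text{ even}\}|$, $k=\lfloor\log_2 e\rfloor$ (so that the sequences below have length $k+1=\lceil\log_2(e+1)\rceil$, which is $0$ for $e=0$), $C_\_=C\cup\{\_\}$. For a sequence $\mathbf b=b_k,\ldots,b_0$ over $C_\_$ put $\mathsf{value}(\mathbf b)=\sum\{2^i: b_i\ne\_\text{ and }b_i\text{ is even}\}$. $\mathbb W$ consists of a special element $\mathsf{won}$ and all sequences $\mathbf b=b_k,\ldots,b_0$ over $C_\_$ with $\mathsf{value}(\mathbf b)\le e$ and $b_i\ge b_j$ whenever $i>j$ and $b_i,b_j\neq\_$. Order. On $C_\_$: $b\succeq c$ iff $c=\_$; or $c$ is odd and either $b$ is even, or $b$ is odd and $b\le c$; or $c$ and $b$ are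 even and $b\ge c$. Sequences are compared by $\sqsupseteq$, the lexicographic order from position $k$ down to $0$ with entries compared by $\succeq$; $\mathsf{won}$ is strictly larger than every sequence. Updates. For a sequence $\mathbf b\in\mathbb W$ and a vertex $v$ with $d=\phi(v)$, the raw update $\mathsf{ru}(\mathbf b,v)$ is the $\sqsubseteq$-largest sequence $\mathbf c$ obtainable by one of the rules: (i) for an index $0\le j\le k$ such that $b_i$ is even (and $\ne\_$) for all $i<j$, and $b_i=\_$ or $b_i\ge d$ for all $i>j$: $c_i=b_i$ for $i>j$, $c_j=d$, $c_i=\_$ for $i<j$; (ii) for an index $j$ with $b_j\ne\_$, $d>b_j$, and $b_i=\_$ or $b_i\ge d$ for all $i>j$: $c_i=b_i$ for $i>j$, $c_j=d$, $c_i=\_$ for $i<j$; (iii) if for all $j\le k$, $b_j=\_$ or $b_j\ge d$: $\mathbf c=\mathbf b$. Then $\mathsf{up}(\mathbf b,v)=\mathsf{ru}(\mathbf b,v)$ if $\mathsf{value}(\mathsf{ru}(\mathbf b,v))\le e$, and $\mathsf{up}(\mathbf b,v)=\mathsf{won}$ otherwise; $\mathsf{up}(\mathsf{won},v)=\mathsf{won}$. The antagonistic update is $\mathsf{au}(\mathbf b,v)=\min_\sqsubseteq\{\mathsf{up}(\mathbf c,v): \mathbf c\in\mathbb W,\ \mathbf c\sqsupseteq\mathbf b\}$. Update games. The players move the token as in the parity game, from an initial vertex $v_0$; player even can stop at any time. When she stops after the partial play $v_0,\ldots,v_n$, it is evaluated starting with $\_,\ldots,\_$ and applying the update with each vertex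 in turn: in the forward game in the order $v_0,v_1,\ldots,v_n$, in the backward game in the order $v_n,v_{n-1},\ldots,v_0$. In the basic update game the update is $\mathsf{up}$, in the antagonistic update game it is $\mathsf{au}$. Even has won if the final value is $\mathsf{won}$ (she loses if she never stops). Even can win from $v$ if she has a strategy (for moving and stopping) that guarantees this against every play of odd starting at $v$.
   Formalization: up(b,v) is also won when φ(v) and all entries of b are even (a carry beyond index k). Without this, won is unreachable if e = 2^(k+1)−1 > 0, e.g. one vertex of colour 2 with a loop, and the claim fails; for other e, no update of a sequence in W changes. -}

module Defs where

open import Level using (0ℓ)
open import Data.Bool.Base using (Bool; true; false; if_then_else_)
open import Data.Fin.Base using (Fin; toℕ; opposite)
import Data.Fin.Base as Fin
import Data.Fin.Properties as Fin
open import Data.List.Base as List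
  using (List; []; _∷_; allFin; applyUpTo; cartesianProductWith; filter; foldl; foldr)
import Data.List.Extrema as Extrema
open import Data.List.Membership.Propositional using (_∈_)
import Data.List.Relation.Unary.All as List using (All)
open import Data.Maybe.Base using (Maybe; just; nothing)
open import Data.Maybe.Properties using (≡-dec)
open import Data.Maybe.Relation.Unary.All as All using (All)
open import Data.Maybe.Relation.Unary.Any as Any using (Any)
open import Data.Nat.Base using (ℕ; suc; _+_; _^_; _≤_; _<_)
import Data.Nat.Properties as ℕ
open import Data.Nat.Divisibility using (_∣_; _∣?_)
open import Data.Nat.ListAction using (sum)
open import Data.Nat.Logarithm using (⌈log₂_⌉)
open import Data.Product.Base using (∃; _×_; _,_; proj₁)
open import Data.Sum.Base using (_⊎_; inj₁; inj₂)
open import Data.Vec.Base as Vec using (Vec; lookup; tabulate; replicate)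
import Data.Vec.Relation.Binary.Lex.NonStrict as Lex
open import Function.Base using (_∘_; flip)
open import Relation.Binary.Bundles using (DecTotalOrder)
open import Relation.Binary.Core using (Rel)
open import Relation.Binary.Definitions
  using (Decidable; Reflexive; Transitive; Antisymmetric; Total)
import Relation.Binary.Construct.Add.Supremum.NonStrict as Supremum
open import Relation.Binary.PropositionalEquality.Core using (_≡_; refl; cong)
open import Relation.Binary.PropositionalEquality.Properties using (isEquivalence)
open import Relation.Nullary.Construct.Add.Supremum using (_⁺; [_]; ⊤⁺)
open import Relation.Nullary.Decidable.Core
  using (Dec; yes; no; does; _×-dec_; _⊎-dec_; _→-dec_)
open import Relation.Nullary.Negation.Core using (¬_; contradiction)

Even Odd : ℕ → Set
Even c = 2 ∣ c
Odd  c = ¬ Even c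

even? : ∀ c → Dec (Even c)
even? c = 2 ∣? c

------------------------------------------------------------------------
-- Parity games

data Player : Set where
  even odd : Player

record ParityGame : Set₁ where
  field
    n       : ℕ

  Vertex : Set
  Vertex = Fin n

  field
    owner   : Vertex → Player
    Edge    : Rel Vertex 0ℓ
    Edge?   : Decidable Edge
    total   : ∀ v → ∃ (Edge v)
    -- The finite set of colours, as a list whose order and repetitions
    -- are irrelevant.
    colours : List ℕ
    colours-positive : List.All (0 <_) colours
    φ       : Vertex → ℕ
    φ∈colours : ∀ v → φ v ∈ colours

EventuallyAtMost : (ℕ → ℕ) → ℕ → Set
EventuallyAtMost a c = ∃ λ N → ∀ i → N ≤ i → a i ≤ c

IsLimsup : (ℕ → ℕ) → ℕ → Set
IsLimsup a c = EventuallyAtMost a c × (∀ d → EventuallyAtMost a d → c ≤ d)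

module ParityGameSemantics (G : ParityGame) where
  open ParityGame G

  Play : Set
  Play = ℕ → Vertex

  IsPlayFrom : Vertex → Play → Set
  IsPlayFrom v ρ = ρ 0 ≡ v × (∀ i → Edge (ρ i) (ρ (suc i)))

  -- The first argument is the list of vertices visited before the
  -- current one, oldest first.
  MoveStrategy : Set
  MoveStrategy = List Vertex → (v : Vertex) → owner v ≡ even → ∃ (Edge v)

  Consistent : MoveStrategy → Play → Set
  Consistent σ ρ =
    ∀ i (o : owner (ρ i) ≡ even) → ρ (suc i) ≡ proj₁ (σ (applyUpTo ρ i) (ρ i) o)

  -- The limit superior of an arbitrary play cannot be computed, so its
  -- existence is asserted classically, by a double negation.
  WonByEven : Play → Set
  WonByEven ρ = ¬ ¬ (∃ λ c → IsLimsup (φ ∘ ρ) c × Even c)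

  WinsParityGame : Vertex → Set
  WinsParityGame v =
    ∃ λ (σ : MoveStrategy) → ∀ ρ → IsPlayFrom v ρ → Consistent σ ρ → WonByEven ρ

------------------------------------------------------------------------
-- Witness sequences: entries and their order

-- nothing is the blank _.
Entry : Set
Entry = Maybe ℕ

infix 4 _≼_ _≼?_

data _≼_ : Rel Entry 0ℓ where
  blank     : ∀ {b} → nothing ≼ b
  odd-even  : ∀ {c b} → Odd c → Even b → just c ≼ just b
  odd-odd   : ∀ {c b} → Odd c → Odd b → b ≤ c → just c ≼ just b
  even-even : ∀ {c b} → Even c → Even b → c ≤ b → just c ≼ just b

≼-refl : Reflexive _≼_
≼-refl {nothing} = blank
≼-refl {just c} with even? c
... | yes e = even-even e e ℕ.≤-refl
... | no  o = odd-odd o o ℕ.≤-refl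

≼-trans : Transitive _≼_
≼-trans blank             _                 = blank
≼-trans (odd-even o _)    (even-even _ e _) = odd-even o e
≼-trans (odd-even _ e)    (odd-even o _)    = contradiction e o
≼-trans (odd-even _ e)    (odd-odd o _ _)   = contradiction e o
≼-trans (odd-odd o _ _)   (odd-even _ e)    = odd-even o e
≼-trans (odd-odd o _ p)   (odd-odd _ o′ q)  = odd-odd o o′ (ℕ.≤-trans q p)
≼-trans (odd-odd _ o _)   (even-even e _ _) = contradiction e o
≼-trans (even-even _ e _) (odd-even o _)    = contradiction e o
≼-trans (even-even _ e _) (odd-odd o _ _)   = contradiction e o
≼-trans (even-even e _ p) (even-even _ e′ q) = even-even e e′ (ℕ.≤-trans p q)

≼-antisym : Antisymmetric _≡_ _≼_
≼-antisym blank             blank             = refl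
≼-antisym (odd-even o _)    (odd-even _ e)    = contradiction e o
≼-antisym (odd-even _ e)    (odd-odd o _ _)   = contradiction e o
≼-antisym (odd-even o _)    (even-even _ e _) = contradiction e o
≼-antisym (odd-odd o _ _)   (odd-even _ e)    = contradiction e o
≼-antisym (odd-odd _ _ p)   (odd-odd _ _ q)   = cong just (ℕ.≤-antisym q p)
≼-antisym (odd-odd _ o _)   (even-even e _ _) = contradiction e o
≼-antisym (even-even _ e _) (odd-even o _)    = contradiction e o
≼-antisym (even-even _ e _) (odd-odd o _ _)   = contradiction e o
≼-antisym (even-even _ _ p) (even-even _ _ q) = cong just (ℕ.≤-antisym p q)

≼-total : Total _≼_
≼-total nothing  _        = inj₁ blank
≼-total (just _) nothing  = inj₂ blank
≼-total (just c) (just b) with even? c | even? b | ℕ.≤-total c b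
... | yes p | yes q | inj₁ r = inj₁ (even-even p q r)
... | yes p | yes q | inj₂ r = inj₂ (even-even q p r)
... | yes p | no  q | _      = inj₂ (odd-even q p)
... | no  p | yes q | _      = inj₁ (odd-even p q)
... | no  p | no  q | inj₁ r = inj₂ (odd-odd q p r)
... | no  p | no  q | inj₂ r = inj₁ (odd-odd p q r)

_≼?_ : Decidable _≼_
c ≼? b with ≼-total c b | ≡-dec ℕ._≟_ c b
... | inj₁ c≼b | _        = yes c≼b
... | inj₂ _   | yes refl = yes ≼-refl
... | inj₂ b≼c | no c≢b   = no λ c≼b → c≢b (≼-antisym c≼b b≼c)

entryOrder : DecTotalOrder 0ℓ 0ℓ 0ℓ
entryOrder = record
  { Carrier = Entry
  ; _≈_     = _≡_
  ; _≤_     = _≼_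
  ; isDecTotalOrder = record
    { isTotalOrder = record
      { isPartialOrder = record
        { isPreorder = record
          { isEquivalence = isEquivalence
          ; reflexive     = λ { refl → ≼-refl }
          ; trans         = ≼-trans
          }
        ; antisym = ≼-antisym
        }
      ; total = ≼-total
      }
    ; _≟_  = ≡-dec ℕ._≟_
    ; _≤?_ = _≼?_
    }
  }

------------------------------------------------------------------------
-- Sequences

-- The sequence b_{l-1}, …, b_0 is stored in reading order, so that the
-- lexicographic order of vectors compares position l-1 first; the entry
-- with index i is at vector position l-1-i.
Seq : ℕ → Set
Seq l = Vec Entry l

at : ∀ {l} → Seq l → Fin l → Entry
at b i = lookup b (opposite i)

fromIndex : ∀ {l} → (Fin l → Entry) → Seq l
fromIndex f = tabulate (f ∘ opposite)

blanks : ∀ l → Seq l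
blanks l = replicate l nothing

seqOrder : ℕ → DecTotalOrder 0ℓ 0ℓ 0ℓ
seqOrder = Lex.≤-decTotalOrder entryOrder

value : ∀ {l} → Seq l → ℕ
value {l} b =
  sum (List.map (λ i → 2 ^ toℕ i)
    (filter (λ i → Any.dec even? (at b i)) (allFin l)))

Decreasing : ∀ {l} → Seq l → Set
Decreasing b =
  ∀ i j → j Fin.< i → All (λ bᵢ → All (λ bⱼ → bⱼ ≤ bᵢ) (at b j)) (at b i)

decreasing? : ∀ {l} (b : Seq l) → Dec (Decreasing b)
decreasing? b = Fin.all? λ i → Fin.all? λ j →
  (j Fin.<? i) →-dec All.dec (λ bᵢ → All.dec (λ bⱼ → bⱼ ℕ.≤? bᵢ) (at b j)) (at b i)

sequencesOver : List Entry → ∀ l → List (Seq l)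
sequencesOver xs ℕ.zero    = Vec.[] ∷ []
sequencesOver xs (ℕ.suc l) = cartesianProductWith Vec._∷_ xs (sequencesOver xs l)

------------------------------------------------------------------------
-- Raw updates

module _ {l : ℕ} where

  BlankOrAtLeastAbove : Seq l → ℕ → Fin l → Set
  BlankOrAtLeastAbove b d j = ∀ i → j Fin.< i → All (d ≤_) (at b i)

  RuleI RuleII : Seq l → ℕ → Fin l → Set
  RuleI  b d j = (∀ i → i Fin.< j → Any Even (at b i)) × BlankOrAtLeastAbove b d j
  RuleII b d j = Any (_< d) (at b j) × BlankOrAtLeastAbove b d j

  RuleIII : Seq l → ℕ → Set
  RuleIII b d = ∀ j → All (d ≤_) (at b j)

  blankOrAtLeastAbove? : ∀ b d j → Dec (BlankOrAtLeastAbove b d j)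
  blankOrAtLeastAbove? b d j = Fin.all? λ i →
    (j Fin.<? i) →-dec All.dec (d ℕ.≤?_) (at b i)

  ruleI? : ∀ b d j → Dec (RuleI b d j)
  ruleI? b d j =
    (Fin.all? λ i → (i Fin.<? j) →-dec Any.dec even? (at b i))
      ×-dec blankOrAtLeastAbove? b d j

  ruleII? : ∀ b d j → Dec (RuleII b d j)
  ruleII? b d j = Any.dec (ℕ._<? d) (at b j) ×-dec blankOrAtLeastAbove? b d j

  ruleIII? : ∀ b d → Dec (RuleIII b d)
  ruleIII? b d = Fin.all? λ j → All.dec (d ℕ.≤?_) (at b j)

  replaceAt : Seq l → ℕ → Fin l → Seq l
  replaceAt b d j = fromIndex λ i →
    if does (j Fin.<? i) then at b i else
    if does (i Fin.≟ j)  then just d else nothing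

  candidates : Seq l → ℕ → List (Seq l)
  candidates b d =
    List.map (replaceAt b d)
      (filter (λ j → ruleI? b d j ⊎-dec ruleII? b d j) (allFin l))
    List.++ filter (λ c → ruleIII? c d) (b ∷ [])

  -- Some rule always applies (rule II at the largest j with b_j < d, if
  -- rule III does not), so the default, which is the least sequence, does
  -- not affect the maximum.
  rawUpdate : Seq l → ℕ → Seq l
  rawUpdate b d = max (blanks l) (candidates b d)
    where open Extrema (DecTotalOrder.totalOrder (seqOrder l))

  -- Rule I at the index l, one beyond the sequence: adding d to l even
  -- entries carries into an even entry of weight 2 ^ l.
  Carry : Seq l → ℕ → Set
  Carry b d = Even d × (∀ i → Any Even (at b i))

  carry? : ∀ b d → Dec (Carry b d)
  carry? b d = even? d ×-dec Fin.all? λ i → Any.dec even? (at b i)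

------------------------------------------------------------------------
-- Update games

data Direction : Set where
  forward backward : Direction

data Kind : Set where
  basic antagonistic : Kind

module UpdateGames (G : ParityGame) where
  open ParityGame G
  open ParityGameSemantics G

  e : ℕ
  e = List.length (filter (even? ∘ φ) (allFin n))

  len : ℕ
  len = ⌈log₂ suc e ⌉

  -- ⊤⁺ is won.
  Witness : Set
  Witness = Seq len ⁺

  witnessOrder : DecTotalOrder 0ℓ 0ℓ 0ℓ
  witnessOrder = record
    { isDecTotalOrder =
        Supremum.≤⁺-isDecTotalOrder _ (DecTotalOrder.isDecTotalOrder (seqOrder len)) }

  open DecTotalOrder witnessOrder using () renaming (_≤_ to _⊑_; _≤?_ to _⊑?_) public
  open Extrema (DecTotalOrder.totalOrder witnessOrder) using (min)

  𝕎 : List Witness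
  𝕎 = ⊤⁺ ∷ List.map [_]
        (filter (λ b → (value b ℕ.≤? e) ×-dec decreasing? b)
          (sequencesOver (nothing ∷ List.map just colours) len))

  -- A carry produces the value 2 ^ len > e, hence won.  If 1 + e is not a
  -- power of two, or e = 0, no carry arises from a sequence in 𝕎.  If
  -- e = 2 ^ len - 1 > 0, no sequence of length len has value above e, so
  -- that won would be unreachable without the carry, already for a single
  -- even-coloured vertex with a loop.
  up : Witness → Vertex → Witness
  up ⊤⁺    v = ⊤⁺
  up [ b ] v =
    if does (carry? b (φ v)) then ⊤⁺ else
    if does (value (rawUpdate b (φ v)) ℕ.≤? e) then [ rawUpdate b (φ v) ] else ⊤⁺

  -- The default ⊤⁺ is itself one of the values minimised, as up ⊤⁺ v.
  au : Witness → Vertex → Witness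
  au b v = min ⊤⁺ (List.map (λ c → up c v) (filter (b ⊑?_) 𝕎))

  update : Kind → Witness → Vertex → Witness
  update basic        = up
  update antagonistic = au

  evaluate : Direction → Kind → List Vertex → Witness
  evaluate forward  k vs = foldl (update k) [ blanks len ] vs
  evaluate backward k vs = foldr (flip (update k)) [ blanks len ] vs

  -- Whether to stop after the given nonempty partial play, oldest vertex
  -- first.
  StopStrategy : Set
  StopStrategy = List Vertex → Bool

  prefix : Play → ℕ → List Vertex
  prefix ρ m = applyUpTo ρ (suc m)

  StopsAt : StopStrategy → Play → ℕ → Set
  StopsAt τ ρ m = τ (prefix ρ m) ≡ true × (∀ i → i < m → τ (prefix ρ i) ≡ false)

  -- Since every partial play extends to an infinite one, the plays of odd
  -- are represented by infinite plays, of which only the part up to the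
  -- stopping time matters.
  WinsUpdateGame : Direction → Kind → Vertex → Set
  WinsUpdateGame dir k v =
    ∃ λ (σ : MoveStrategy) → ∃ λ (τ : StopStrategy) →
      ∀ ρ → IsPlayFrom v ρ → Consistent σ ρ →
        ∃ λ m → StopsAt τ ρ m × evaluate dir k (prefix ρ m) ≡ ⊤⁺

{-# OPTIONS --safe #-}

-- Parity games are positionally determined, even when play stops outside a
-- set S at vertices with prescribed outcome: take x in S of largest colour,
-- solve S - x with x awarded to the player of its parity, and keep that
-- solution if this player can indeed move from x into his region; otherwise
-- the opponent keeps his region and x, and what remains of S is solved again.
-- In the region of a player every cycle has a largest colour of his parity.
--
-- A word evaluated to won by basic updates yields more than e vertices of even
-- colour, joined by walks whose colours do not exceed those of their ends.
-- Two of these vertices coincide, which closes a cycle with an even largest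
-- colour; so even cannot win an update game from a vertex of odd's region.
--
-- Conversely, fix a colour d and let entries below d count as one odd entry
-- better than all others, ignoring what follows them.  In the resulting order
-- no update with a colour below d decreases a sequence, and an update with d
-- increases it if d is even; as the order coarsens that of the sequences, both
-- hold for antagonistic updates.  Hence an even colour occurs boundedly often
-- before a larger one or won is reached, and so does an odd colour if there is
-- no cycle whose largest colour is odd.  Even therefore wins every update game
-- from her region within a fixed number of steps.
--
-- A cycle of the reversed graph is a reversed cycle, so that forward and
-- backward evaluation need no separate treatment.

module Submission where

open import Defs
open import Axiom.UniquenessOfIdentityProofs using (module Decidable⇒UIP)
open import Data.Bool.Base using (if_then_else_)
open import Data.Empty using (⊥)
open import Data.Fin.Base as Fin using (Fin; toℕ; fromℕ; inject₁; opposite)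
import Data.Fin.Properties as Fin
open import Data.Fin.Relation.Unary.Top using (view; ‵fromℕ; ‵inject₁)
open import Data.Fin.Subset using (Subset; _-_; ⁅_⁆; _⊂_)
  renaming (_∈_ to _∈ₛ_; _∉_ to _∉ₛ_; ⊤ to full)
open import Data.Fin.Subset.Induction using (⊂-wellFounded)
import Data.Fin.Subset.Properties as Sub
open import Data.List.Base as List
  using (List; []; _∷_; _++_; _∷ʳ_; _ʳ++_; allFin; applyUpTo; filter; foldl; head; length; reverse)
import Data.List.Extrema as Extrema
import Data.List.Extrema.Nat as ℕ-Extrema
open import Data.List.Membership.Propositional using (_∈_)
import Data.List.Membership.Propositional.Properties as ∈
import Data.List.Properties as List
import Data.List.Relation.Unary.All as LAll
import Data.List.Relation.Unary.All.Properties as LAll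
open import Data.List.Relation.Unary.AllPairs using (AllPairs; []; _∷_)
open import Data.List.Relation.Unary.Any as LAny using (here; there)
import Data.List.Relation.Unary.Any.Properties as LAny
open import Data.List.Relation.Unary.Linked as Linked using (Linked; []; [-]; _∷_)
import Data.List.Relation.Unary.Linked.Properties as Linked
open import Data.Maybe.Base using (Maybe; just; nothing)
open import Data.Maybe.Relation.Unary.All as MAll using (All; just; nothing)
open import Data.Maybe.Relation.Unary.Any as MAny using (Any; just)
open import Data.Nat.Base
open import Data.Nat.Divisibility using (divides)
open import Data.Nat.Induction using (<-wellFounded)
open import Data.Nat.ListAction using (sum)
open import Data.Nat.Logarithm using (⌈log₂_⌉)
open import Data.Nat.Logarithm.Core using (⌈log2⌉)
import Data.Nat.Properties as ℕ
open import Data.Product.Base as Product using (∃; ∃₂; _×_; _,_; proj₁; proj₂)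
open import Data.Sum.Base as Sum using (_⊎_; inj₁; inj₂; [_,_]′)
open import Data.Unit.Base using (⊤; tt)
open import Data.Vec.Base as Vec using ([]; _∷_)
import Data.Vec.Properties as Vec
open import Data.Vec.Relation.Binary.Lex.Core using (base; this; next)
open import Data.Vec.Relation.Unary.All as VAll using ([]; _∷_)
import Data.Vec.Relation.Unary.All.Properties as VAll
open import Function.Base using (_∘_; case_of_; flip; id)
open import Function.Bundles using (_⇔_; mk⇔)
open import Induction.WellFounded using (Acc; acc)
open import Level using (0ℓ)
open import Relation.Binary.Bundles using (DecTotalOrder)
import Relation.Binary.Construct.Add.Supremum.NonStrict as Supremum
open import Relation.Binary.Definitions using (tri<; tri≈; tri>)
open import Relation.Binary.PropositionalEquality
open import Relation.Nullary using (¬_; Dec; yes; no; does; contradiction)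
open import Relation.Nullary.Construct.Add.Supremum using (⊤⁺; [_])
open import Relation.Nullary.Decidable using (dec-false; dec-true; ¬?; _×-dec_; _⊎-dec_)
open import Relation.Unary using (Decidable; Pred)

-- Positional determinacy

_≟ₚ_ : (p q : Player) → Dec (p ≡ q)
even ≟ₚ even = yes refl
even ≟ₚ odd  = no λ ()
odd  ≟ₚ even = no λ ()
odd  ≟ₚ odd  = yes refl

opponent : Player → Player
opponent even = odd
opponent odd  = even

≢⇒≡opponent : ∀ {p q} → p ≢ q → p ≡ opponent q
≢⇒≡opponent {even} {even} p≢q = contradiction refl p≢q
≢⇒≡opponent {even} {odd}  p≢q = refl
≢⇒≡opponent {odd}  {even} p≢q = refl
≢⇒≡opponent {odd}  {odd}  p≢q = contradiction refl p≢q

parityOf : ℕ → Player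
parityOf c with even? c
... | yes _ = even
... | no  _ = odd

Even⇒parityOf : ∀ {c} → Even c → parityOf c ≡ even
Even⇒parityOf {c} e with even? c
... | yes _ = refl
... | no  o = contradiction e o

parityOf⇒Even : ∀ {c} → parityOf c ≡ even → Even c
parityOf⇒Even {c} eq with even? c
... | yes e = e

-- The index c is the largest colour on the walk, both ends included.
data Walk {A : Set} (φ : A → ℕ) (R : A → A → Set) : ℕ → A → A → Set where
  [_] : ∀ {x y} → R x y → Walk φ R (φ x ⊔ φ y) x y
  _∷_ : ∀ {x y z c} → R x y → Walk φ R c y z → Walk φ R (φ x ⊔ c) x z

module _ {n : ℕ} {P : Fin n → Set} (P? : ∀ v → Dec (P v)) where

  select : Subset n
  select = Vec.tabulate (does ∘ P?)

  ∈-select⁺ : ∀ {v} → P v → v ∈ₛ select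
  ∈-select⁺ {v} p = Vec.lookup⇒[]= v select
    (trans (Vec.lookup∘tabulate (does ∘ P?) v) (dec-true (P? v) p))

  ∈-select⁻ : ∀ {v} → v ∈ₛ select → P v
  ∈-select⁻ {v} v∈ with P? v | trans (sym (Vec.lookup∘tabulate (does ∘ P?) v)) (Vec.[]=⇒lookup v∈)
  ... | yes p | _ = p

-- If x were in `p - x`, removing it again would make the set strictly smaller; but a second removal
-- changes nothing.
x∉p-x : ∀ {n} (p : Subset n) x → x ∉ₛ (p - x)
x∉p-x p x x∈p-x with Sub.x∈p⇒p-x⊂p x∈p-x
... | _ , y , y∈p-x , y∉p-x-x = y∉p-x-x (subst (y ∈ₛ_) (sym (Sub.p─q─q≡p─q p ⁅ x ⁆)) y∈p-x)

maximal : ∀ {n} (f : Fin n → ℕ) (S : Subset n) {v} → v ∈ₛ S →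
          ∃ λ x → x ∈ₛ S × (∀ {y} → y ∈ₛ S → f y ≤ f x)
maximal {n} f S {v} v∈S = x , x∈S , λ y∈S →
    LAll.lookup (ℕ-Extrema.f[xs]≤f[argmax] v elements) (∈.∈-filter⁺ (Sub._∈? S) (∈.∈-allFin _) y∈S)
  where
  elements = filter (Sub._∈? S) (allFin n)
  x = ℕ-Extrema.argmax f v elements
  x∈S : x ∈ₛ S
  x∈S with ℕ-Extrema.argmax-sel f v elements
  ... | inj₁ x≡v rewrite x≡v = v∈S
  ... | inj₂ x∈ = proj₂ (∈.∈-filter⁻ (Sub._∈? S) {xs = allFin n} x∈)

module Determinacy (G : ParityGame) where
  open ParityGame G

  -- Only the player who wins x is held to `move`; the loser may take any edge. One pair `winner`,
  -- `move` thus holds positional strategies for both players.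
  Obeys : (Vertex → Player) → (∀ v → ∃ (Edge v)) → Vertex → Vertex → Set
  Obeys winner move x y = Edge x y × (owner x ≡ winner x → y ≡ proj₁ (move x))

  -- A game in which play stops on leaving S, at a vertex v outside S with
  -- outcome terminal v.
  record Solution (S : Subset n) (terminal : Vertex → Player) : Set where
    field
      winner   : Vertex → Player
      move     : ∀ v → ∃ (Edge v)
      boundary : ∀ {v} → v ∉ₛ S → winner v ≡ terminal v

    Step : Vertex → Vertex → Set
    Step x y = x ∈ₛ S × Obeys winner move x y

    field
      closed : ∀ {x y} → Step x y → winner y ≡ winner x
      cycles : ∀ {c x} → Walk φ Step c x x → parityOf c ≡ winner x

  -- The player r can force the next vertex into his region: by the move m if
  -- he owns x, and whatever the move is otherwise.
  attracted : (winner : Vertex → Player) (x : Vertex) →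
    ∃₂ λ r (m : ∃ (Edge x)) → ∀ {y} → Edge x y → (owner x ≡ r → y ≡ proj₁ m) → winner y ≡ r
  attracted winner x with Fin.any? (λ y → Edge? x y ×-dec (winner y ≟ₚ owner x))
  ... | yes (y , e , eq) = owner x , (y , e) , λ _ f → trans (cong winner (f refl)) eq
  ... | no  none = opponent (owner x) , total x , λ {y} e _ → ≢⇒≡opponent λ eq → none (y , e , eq)

  _[_↦_] : {B : Vertex → Set} → (∀ v → B v) → (x : Vertex) → B x → ∀ v → B v
  (f [ x ↦ b ]) v with x Fin.≟ v
  ... | yes refl = b
  ... | no  _    = f v

  [↦]-same : ∀ {B : Vertex → Set} (f : ∀ v → B v) x b → (f [ x ↦ b ]) x ≡ b
  [↦]-same f x b with x Fin.≟ x
  ... | yes refl = refl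
  ... | no  x≢x  = contradiction refl x≢x

  [↦]-other : ∀ {B : Vertex → Set} (f : ∀ v → B v) x b {v} → x ≢ v → (f [ x ↦ b ]) v ≡ f v
  [↦]-other f x b {v} x≢v with x Fin.≟ v
  ... | yes refl = contradiction refl x≢v
  ... | no  _    = refl

  module _ (S : Subset n) (terminal : Vertex → Player)
           {x₀ : Vertex} (x₀∈S : x₀ ∈ₛ S) (top : ∀ {y} → y ∈ₛ S → φ y ≤ φ x₀)
           where

    p : Player
    p = parityOf (φ x₀)

    module _ (sub : Solution (S - x₀) (terminal [ x₀ ↦ p ])) where
      open Solution sub renaming (winner to w; move to μ; Step to Step₁)

      w-x₀ : w x₀ ≡ p
      w-x₀ = trans (boundary (x∉p-x S x₀)) ([↦]-same terminal x₀ p)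

      S-x₀⊂S : (S - x₀) ⊂ S
      S-x₀⊂S = Sub.x∈p⇒p-x⊂p x₀∈S

      -- The player p favoured by the colour of x₀ does win from x₀.
      module Keep (m : ∃ (Edge x₀))
        (stay : ∀ {y} → Edge x₀ y → (owner x₀ ≡ p → y ≡ proj₁ m) → w y ≡ p) where

        μ′ = μ [ x₀ ↦ m ]

        Step′ : Vertex → Vertex → Set
        Step′ x y = x ∈ₛ S × Obeys w μ′ x y

        step₁ : ∀ {x y} → x₀ ≢ x → Step′ x y → Step₁ x y
        step₁ {x} x₀≢x (x∈S , e , f) =
          Sub.x∈p∧x≢y⇒x∈p-y x∈S (x₀≢x ∘ sym) , e ,
          λ eq → trans (f eq) (cong proj₁ ([↦]-other {B = λ v → ∃ (Edge v)} μ x₀ m x₀≢x))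

        leave : ∀ {y} → Step′ x₀ y → w y ≡ p
        leave (_ , e , f) = stay e λ eq →
          trans (f (trans eq (sym w-x₀)))
                (cong {A = ∃ (Edge x₀)} proj₁ ([↦]-same {B = λ v → ∃ (Edge v)} μ x₀ m))

        closed′ : ∀ {x y} → Step′ x y → w y ≡ w x
        closed′ {x} s = case x₀ Fin.≟ x of λ where
          (yes refl) → trans (leave s) (sym w-x₀)
          (no x₀≢x)  → closed (step₁ x₀≢x s)

        bounded : ∀ {c x y} → Walk φ Step′ c x y → φ y ≤ φ x₀ → c ≤ φ x₀
        bounded [ x∈S , _ ]       y≤ = ℕ.⊔-lub (top x∈S) y≤
        bounded ((x∈S , _) ∷ xsy) y≤ = ℕ.⊔-lub (top x∈S) (bounded xsy y≤)

        -- No colour on the walk exceeds `φ x₀`. If some step leaves `x₀`, this maximum is attained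
        -- and `closed′` carries the winner p back to the start; otherwise all steps belong to the
        -- subgame.
        through : ∀ {c x y} → Walk φ Step′ c x y → φ y ≤ φ x₀ →
                  (c ≡ φ x₀ × w x ≡ p) ⊎ Walk φ Step₁ c x y
        through {x = x} [ s ] y≤ = case x₀ Fin.≟ x of λ where
          (yes refl) → inj₁ (ℕ.m≥n⇒m⊔n≡m y≤ , w-x₀)
          (no x₀≢x)  → inj₂ [ step₁ x₀≢x s ]
        through {x = x} (s ∷ xsy) y≤ = case (x₀ Fin.≟ x) , through xsy y≤ of λ where
          (yes refl , _)             → inj₁ (ℕ.m≥n⇒m⊔n≡m (bounded xsy y≤) , w-x₀)
          (no _ , inj₁ (refl , w≡p)) →
            inj₁ (ℕ.m≤n⇒m⊔n≡n (top (proj₁ s)) , trans (sym (closed′ s)) w≡p)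
          (no x₀≢x , inj₂ xsy′)      → inj₂ (step₁ x₀≢x s ∷ xsy′)

        source : ∀ {c x y} → Walk φ Step′ c x y → x ∈ₛ S
        source [ x∈S , _ ]     = x∈S
        source ((x∈S , _) ∷ _) = x∈S

        solution : Solution S terminal
        solution = record
          { winner   = w
          ; move     = μ′
          ; boundary = λ v∉S →
              trans (boundary (v∉S ∘ proj₁ S-x₀⊂S))
                    ([↦]-other terminal x₀ p λ { refl → v∉S x₀∈S })
          ; closed   = closed′
          ; cycles   = λ xx → [ (λ { (refl , w≡p) → sym w≡p }) , cycles ]′
                                (through xx (top (source xx)))
          }

      -- The opponent r wins from x₀; his region and x₀ are settled, U is not.
      module Split {r : Player} (r≢p : r ≢ p) (m : ∃ (Edge x₀))
        (stay : ∀ {y} → Edge x₀ y → (owner x₀ ≡ r → y ≡ proj₁ m) → w y ≡ r) where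

        undecided? : ∀ v → Dec (v ∈ₛ (S - x₀) × w v ≢ r)
        undecided? v = (v Sub.∈? (S - x₀)) ×-dec ¬? (w v ≟ₚ r)

        U : Subset n
        U = select undecided?

        U⊂S : U ⊂ S
        U⊂S = (λ v∈U → proj₁ S-x₀⊂S (proj₁ (∈-select⁻ undecided? v∈U)))
            , x₀ , x₀∈S , λ x₀∈U → x∉p-x S x₀ (proj₁ (∈-select⁻ undecided? x₀∈U))

        -- Outside U the outcome is known: r at `x₀` and wherever in `S - x₀` the first solution
        -- awards r, the prescribed one outside S.
        module _ (sub₂ : Solution U (w [ x₀ ↦ r ])) where
          module Sub₂ = Solution sub₂
          open Sub₂ using () renaming (winner to w₂; move to μ₂; Step to Step₂)

          w₂-r : ∀ {v} → w v ≡ r → w₂ v ≡ r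
          w₂-r {v} eq = trans (Sub₂.boundary λ v∈U → proj₂ (∈-select⁻ undecided? v∈U) eq) lem
            where
            lem : (w [ x₀ ↦ r ]) v ≡ r
            lem with x₀ Fin.≟ v
            ... | yes refl = refl
            ... | no  _    = eq

          w₂-x₀ : w₂ x₀ ≡ r
          w₂-x₀ = trans (Sub₂.boundary λ x₀∈U → x∉p-x S x₀ (proj₁ (∈-select⁻ undecided? x₀∈U)))
                        ([↦]-same w x₀ r)

          μ′ : ∀ v → ∃ (Edge v)
          μ′ v with v Sub.∈? U
          ... | yes _ = μ₂ v
          ... | no  _ = (μ [ x₀ ↦ m ]) v

          Step′ : Vertex → Vertex → Set
          Step′ x y = x ∈ₛ S × Obeys w₂ μ′ x y

          data Split (x y : Vertex) : Set where
            inU  : Step₂ x y → Split x y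
            here : x ≡ x₀ → w y ≡ r → Split x y
            inW  : w x ≡ r → Step₁ x y → Split x y

          split : ∀ {x y} → Step′ x y → Split x y
          split {x} (x∈S , e , f) with x Sub.∈? U
          ... | yes x∈U = inU (x∈U , e , f)
          ... | no  x∉U with x₀ Fin.≟ x
          ...   | yes refl = here refl (stay e λ eq → f (trans eq (sym w₂-x₀)))
          ...   | no x₀≢x with w x ≟ₚ r
          ...     | yes eq = inW eq (Sub.x∈p∧x≢y⇒x∈p-y x∈S (x₀≢x ∘ sym) , e ,
                      λ eq′ → f (trans eq′ (trans eq (sym (w₂-r eq)))))
          ...     | no neq = contradiction
                      (∈-select⁺ undecided? (Sub.x∈p∧x≢y⇒x∈p-y x∈S (x₀≢x ∘ sym) , neq)) x∉U

          closed′ : ∀ {x y} → Step′ x y → w₂ y ≡ w₂ x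
          closed′ s with split s
          ... | inU s₂       = Sub₂.closed s₂
          ... | here refl wy = trans (w₂-r wy) (sym w₂-x₀)
          ... | inW wx s₁    = trans (w₂-r (trans (closed s₁) wx)) (sym (w₂-r wx))

          captured : ∀ {x y} → w x ≡ r → Step′ x y → Step₁ x y
          captured wx s with split s
          ... | inU (x∈U , _) = contradiction wx (proj₂ (∈-select⁻ undecided? x∈U))
          ... | here refl _   = contradiction (trans (sym wx) w-x₀) r≢p
          ... | inW _ s₁      = s₁

          captured* : ∀ {c x y} → w x ≡ r → Walk φ Step′ c x y → Walk φ Step₁ c x y × w y ≡ r
          captured* wx [ s ]     = [ captured wx s ] , trans (closed (captured wx s)) wx
          captured* wx (s ∷ xsy) with captured* (trans (closed (captured wx s)) wx) xsy
          ... | xsy′ , wy = captured wx s ∷ xsy′ , wy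

          escapes : ∀ {x y} → Step′ x y → Step₂ x y ⊎ w y ≡ r
          escapes s with split s
          ... | inU s₂    = inj₁ s₂
          ... | here _ wy = inj₂ wy
          ... | inW wx s₁ = inj₂ (trans (closed s₁) wx)

          -- Once r's region of the first solution is entered, `captured*` keeps the walk there. A
          -- cycle not made of steps in U therefore starts in that region, where the first solution
          -- settles its parity.
          escapes* : ∀ {c x y} → Walk φ Step′ c x y → Walk φ Step₂ c x y ⊎ w y ≡ r
          escapes* [ s ] with escapes s
          ... | inj₁ s₂ = inj₁ [ s₂ ]
          ... | inj₂ wy = inj₂ wy
          escapes* (s ∷ xsy) with escapes s | escapes* xsy
          ... | inj₁ s₂ | inj₁ xsy₂ = inj₁ (s₂ ∷ xsy₂)
          ... | inj₂ wx | _         = inj₂ (proj₂ (captured* wx xsy))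
          ... | _       | inj₂ wy   = inj₂ wy

          cycles′ : ∀ {c x} → Walk φ Step′ c x x → parityOf c ≡ w₂ x
          cycles′ xx with escapes* xx
          ... | inj₁ xx₂ = Sub₂.cycles xx₂
          ... | inj₂ wx  = trans (cycles (proj₁ (captured* wx xx))) (trans wx (sym (w₂-r wx)))

          solution : Solution S terminal
          solution = record
            { winner   = w₂
            ; move     = μ′
            ; boundary = λ {v} v∉S → let x₀≢v = λ { refl → v∉S x₀∈S } in
                trans (Sub₂.boundary (v∉S ∘ proj₁ U⊂S)) (trans ([↦]-other w x₀ r x₀≢v)
                  (trans (boundary (v∉S ∘ proj₁ S-x₀⊂S)) ([↦]-other terminal x₀ p x₀≢v)))
            ; closed   = closed′
            ; cycles   = cycles′
            }

  solve : ∀ S → Acc _⊂_ S → ∀ terminal → Solution S terminal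
  solve S (acc rec) terminal with Sub.nonempty? S
  ... | no empty = record
    { winner   = terminal
    ; move     = total
    ; boundary = λ _ → refl
    ; closed   = λ (x∈S , _) → contradiction (_ , x∈S) empty
    ; cycles   = λ { [ x∈S , _ ]     → contradiction (_ , x∈S) empty
                   ; ((x∈S , _) ∷ _) → contradiction (_ , x∈S) empty }
    }
  ... | yes (_ , v∈S) with maximal φ S v∈S
  ...   | x₀ , x₀∈S , top = result
    where
    sub = solve (S - x₀) (rec (Sub.x∈p⇒p-x⊂p x₀∈S)) (terminal [ x₀ ↦ parityOf (φ x₀) ])

    result : Solution S terminal
    result with attracted (Solution.winner sub) x₀
    ... | r , m , stay with r ≟ₚ parityOf (φ x₀)
    ...   | yes refl = Keep.solution S terminal x₀∈S top sub m stay
    ...   | no  r≢p  = Split.solution S terminal x₀∈S top sub r≢p m stay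
      (solve U (rec (Split.U⊂S S terminal x₀∈S top sub r≢p m stay)) _)
      where U = Split.U S terminal x₀∈S top sub r≢p m stay

  determinacy : Solution full (λ _ → even)
  determinacy = solve full (⊂-wellFounded full) (λ _ → even)

-- Walks and limits superior

module _ {A : Set} {φ : A → ℕ} {R : A → A → Set} where

  source≤ : ∀ {c x y} → Walk φ R c x y → φ x ≤ c
  source≤ [ _ ]   = ℕ.m≤m⊔n _ _
  source≤ (_ ∷ _) = ℕ.m≤m⊔n _ _

  target≤ : ∀ {c x y} → Walk φ R c x y → φ y ≤ c
  target≤ [ _ ]   = ℕ.m≤n⊔m _ _
  target≤ (_ ∷ w) = ℕ.≤-trans (target≤ w) (ℕ.m≤n⊔m _ _)

  infixr 5 _◅◅_
  -- The meeting vertex counts in both indices; `source≤` absorbs the duplicate, so the index stays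
  -- exact.
  _◅◅_ : ∀ {c c′ x y z} → Walk φ R c x y → Walk φ R c′ y z → Walk φ R (c ⊔ c′) x z
  _◅◅_ {c′ = c′} (_∷_ {x = x} {c = c} r w) w′ =
    subst (λ k → Walk φ R k _ _) (sym (ℕ.⊔-assoc (φ x) c c′)) (r ∷ (w ◅◅ w′))
  _◅◅_ {c′ = c′} ([_] {x} {y} r) w′ =
    subst (λ k → Walk φ R k _ _)
      (trans (cong (φ x ⊔_) (sym (ℕ.m≤n⇒m⊔n≡n (source≤ w′)))) (sym (ℕ.⊔-assoc (φ x) (φ y) c′)))
      (r ∷ w′)

  list-walk : ∀ {d x y ys} → Linked R (x ∷ ys) → LAll.All (λ z → φ z ≤ d) (x ∷ ys) → y ∈ ys →
              ∃ λ c → Walk φ R c x y × c ≤ d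
  list-walk (r ∷ _) (px LAll.∷ py LAll.∷ _) (here refl) = _ , [ r ] , ℕ.⊔-lub px py
  list-walk (r ∷ l) (px LAll.∷ ps)          (there y∈)  with list-walk l ps y∈
  ... | c , w , c≤d = _ , r ∷ w , ℕ.⊔-lub px c≤d

  play-walk : ∀ {d} (ρ : ℕ → A) → (∀ i → R (ρ i) (ρ (suc i))) → ∀ i j → i < j →
              (∀ k → i ≤ k → φ (ρ k) ≤ d) → ∃ λ c → Walk φ R c (ρ i) (ρ j) × c ≤ d
  play-walk ρ steps i (suc j) i<1+j bound with ℕ.m<1+n⇒m<n∨m≡n i<1+j
  ... | inj₂ refl = _ , [ steps j ] , ℕ.⊔-lub (bound j ℕ.≤-refl) (bound (suc j) (ℕ.n≤1+n j))
  ... | inj₁ i<j with play-walk ρ steps i j i<j bound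
  ...   | _ , w , c≤d = _ , w ◅◅ [ steps j ] , ℕ.⊔-lub c≤d
    (ℕ.⊔-lub (bound j (ℕ.<⇒≤ i<j)) (bound (suc j) (ℕ.m≤n⇒m≤1+n (ℕ.<⇒≤ i<j))))

walk-reverse : ∀ {A : Set} {φ : A → ℕ} {R : A → A → Set} {c x y} →
               Walk φ R c x y → Walk φ (flip R) c y x
walk-reverse {φ = φ} ([_] {x} {y} r) rewrite ℕ.⊔-comm (φ x) (φ y) = [ r ]
walk-reverse {φ = φ} {R} (_∷_ {x} {y} {c = c} r w) =
  subst (λ k → Walk φ (flip R) k _ _)
    (trans (sym (ℕ.⊔-assoc c (φ y) (φ x)))
      (trans (cong (_⊔ φ x) (ℕ.m≥n⇒m⊔n≡m (source≤ w))) (ℕ.⊔-comm c (φ x))))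
    (walk-reverse w ◅◅ [ r ])

-- Induction on an eventual bound: either K is one as well, or `suc K` is the least. This case
-- distinction is classical, hence the double negation.
limsup-exists : ∀ {a : ℕ → ℕ} K → EventuallyAtMost a K → ¬ ¬ ∃ (IsLimsup a)
limsup-exists zero    p none = none (zero , p , λ _ _ → z≤n)
limsup-exists (suc K) p none = limsup-not-below (λ q → limsup-exists K q none)
  where
  limsup-not-below : ¬ ¬ EventuallyAtMost _ K
  limsup-not-below ¬q = none (suc K , p , λ d (N , below) → ℕ.≰⇒> λ d≤K →
    ¬q (N , λ i N≤i → ℕ.≤-trans (below i N≤i) d≤K))

-- If c did not recur after M, the sequence would stay below c from some point on. This is
-- impossible for c = 0 and otherwise makes c - 1 an eventual bound.
limsup-recurs : ∀ {a : ℕ → ℕ} {c} → IsLimsup a c → ∀ M → ¬ ¬ ∃ λ i → M ≤ i × a i ≡ c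
limsup-recurs {a} {c} ((N , below) , least) M never = lower c refl
  where
  small : ∀ i → M ⊔ N ≤ i → a i < c
  small i M⊔N≤i = ℕ.≤∧≢⇒< (below i (ℕ.m⊔n≤o⇒n≤o M N M⊔N≤i))
                          λ eq → never (i , ℕ.m⊔n≤o⇒m≤o M N M⊔N≤i , eq)
  lower : ∀ c′ → c ≢ c′
  lower zero     refl with () ← small (M ⊔ N) ℕ.≤-refl
  lower (suc c′) refl = ℕ.1+n≰n (least c′ (M ⊔ N , λ i p → ℕ.≤-pred (small i p)))

-- Only finitely many choices can be made under a double negation, so k indices are chosen instead
-- of an infinite subsequence.
increasing-sequence : ∀ {Q : ℕ → Set} → (∀ M → ¬ ¬ ∃ λ i → M ≤ i × Q i) → ∀ k M →
  ¬ ¬ ∃ λ (f : Fin k → ℕ) →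
    (∀ i → M ≤ f i × Q (f i)) × (∀ {i j} → i Fin.< j → f i < f j)
increasing-sequence often zero    M none = none ((λ ()) , (λ ()) , λ { {()} })
increasing-sequence often (suc k) M none = often M λ (m , M≤m , q) →
  increasing-sequence often k (suc m) λ (f , above , mono) →
    none ( (λ { Fin.zero → m ; (Fin.suc i) → f i })
         , (λ { Fin.zero    → M≤m , q
              ; (Fin.suc i) → ℕ.≤-trans M≤m (ℕ.<⇒≤ (proj₁ (above i))) , proj₂ (above i) })
         , (λ { {Fin.zero}  {Fin.suc j} _     → proj₁ (above j)
              ; {Fin.suc i} {Fin.suc j} (s≤s i<j) → mono i<j }))

-- After the colours above c have ceased, two of n + 1 visits to colour c are at the same vertex;
-- the walk between them has largest colour c.
limsup-cycle : ∀ {n} {φ : Fin n → ℕ} {R : Fin n → Fin n → Set} (ρ : ℕ → Fin n) →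
  (∀ i → R (ρ i) (ρ (suc i))) → ∀ {c} → IsLimsup (φ ∘ ρ) c →
  ¬ ¬ ∃ λ i → Walk φ R c (ρ i) (ρ i)
limsup-cycle {n} {φ} {R} ρ steps {c} lim@((N , below) , _) none =
  increasing-sequence (limsup-recurs lim) (suc n) N λ (f , above , mono) →
    let i , j , i<j , eq = Fin.pigeonhole (ℕ.n<1+n n) (ρ ∘ f)
        d , w , d≤c = play-walk ρ steps (f i) (f j) (mono i<j)
                        λ k fi≤k → below k (ℕ.≤-trans (proj₁ (above i)) fi≤k)
        d≡c = ℕ.≤-antisym d≤c (subst (_≤ d) (proj₂ (above i)) (source≤ w))
    in none (f i , subst₂ (λ k x → Walk φ R k (ρ (f i)) x) d≡c (sym eq) w)

-- Raw updates

AllV : (Entry → Set) → ∀ {l} → Seq l → Set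
AllV P = VAll.All P

-- Entries are stored highest first while indices count from below: the head has index `fromℕ l`,
-- and the tail keeps its indices under `inject₁`. This turns conditions on indices into recursions
-- on vectors.
opposite-fromℕ : ∀ l → opposite (fromℕ l) ≡ Fin.zero
opposite-fromℕ zero    = refl
opposite-fromℕ (suc l) = cong inject₁ (opposite-fromℕ l)

opposite-inject₁ : ∀ {l} (i : Fin l) → opposite (inject₁ i) ≡ Fin.suc (opposite i)
opposite-inject₁ Fin.zero    = refl
opposite-inject₁ (Fin.suc i) = cong inject₁ (opposite-inject₁ i)

module _ {l} (x : Entry) (b : Seq l) where

  at-fromℕ : at (x ∷ b) (fromℕ l) ≡ x
  at-fromℕ = cong (Vec.lookup (x ∷ b)) (opposite-fromℕ l)

  at-inject₁ : ∀ i → at (x ∷ b) (inject₁ i) ≡ at b i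
  at-inject₁ i = cong (Vec.lookup (x ∷ b)) (opposite-inject₁ i)

module _ {P : Entry → Set} where

  at-all⁺ : ∀ {l} {b : Seq l} → AllV P b → ∀ i → P (at b i)
  at-all⁺ ps i = VAll.lookup⁺ ps (opposite i)

  at-all⁻ : ∀ {l} {b : Seq l} → (∀ i → P (at b i)) → AllV P b
  at-all⁻ {b = b} f = VAll.lookup⁻ λ i →
    subst (P ∘ Vec.lookup b) (Fin.opposite-involutive i) (f (opposite i))

  blanks-all : ∀ {l} → P nothing → AllV P (blanks l)
  blanks-all {zero}  p = []
  blanks-all {suc l} p = p ∷ blanks-all p

inject₁<fromℕ : ∀ {l} (i : Fin l) → inject₁ i Fin.< fromℕ l
inject₁<fromℕ {l} i rewrite Fin.toℕ-fromℕ l = Fin.inject₁ℕ< i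

inject₁-mono-< : ∀ {l} {i j : Fin l} → i Fin.< j → inject₁ i Fin.< inject₁ j
inject₁-mono-< {i = i} {j} i<j rewrite Fin.toℕ-inject₁ i | Fin.toℕ-inject₁ j = i<j

inject₁-cancel-< : ∀ {l} {i j : Fin l} → inject₁ i Fin.< inject₁ j → i Fin.< j
inject₁-cancel-< {i = i} {j} i<j rewrite Fin.toℕ-inject₁ i | Fin.toℕ-inject₁ j = i<j

fromℕ≮ : ∀ {l} (i : Fin (suc l)) → ¬ (fromℕ l Fin.< i)
fromℕ≮ i top<i = ℕ.<⇒≱ top<i (Fin.≤fromℕ i)

replacement : ∀ {l} → Seq l → ℕ → Fin l → Fin l → Entry
replacement b d j i =
  if does (j Fin.<? i) then at b i else
  if does (i Fin.≟ j)  then just d else nothing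

module _ {l} (b : Seq l) (d : ℕ) where

  replacement-same : ∀ i → replacement b d i i ≡ just d
  replacement-same i
    rewrite dec-false (i Fin.<? i) (ℕ.<-irrefl refl) | dec-true (i Fin.≟ i) refl = refl

  replacement-above : ∀ {j i} → j Fin.< i → replacement b d j i ≡ at b i
  replacement-above {j} {i} j<i rewrite dec-true (j Fin.<? i) j<i = refl

  replacement-below : ∀ {j i} → i Fin.< j → replacement b d j i ≡ nothing
  replacement-below {j} {i} i<j
    rewrite dec-false (j Fin.<? i) (ℕ.<-asym i<j) | dec-false (i Fin.≟ j) (Fin.<⇒≢ i<j) = refl

module _ {l} (x : Entry) (b : Seq l) (d : ℕ) where

  replaceAt-fromℕ : replaceAt (x ∷ b) d (fromℕ l) ≡ just d ∷ blanks l
  replaceAt-fromℕ = cong₂ _∷_ (replacement-same (x ∷ b) d (fromℕ l))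
    (trans (Vec.tabulate-cong λ i → replacement-below (x ∷ b) d (inject₁<fromℕ (opposite i)))
           (const-nothing l))
    where
    const-nothing : ∀ l → Vec.tabulate {n = l} (λ _ → nothing) ≡ blanks l
    const-nothing zero    = refl
    const-nothing (suc l) = cong (nothing ∷_) (const-nothing l)

  replaceAt-inject₁ : ∀ j → replaceAt (x ∷ b) d (inject₁ j) ≡ x ∷ replaceAt b d j
  replaceAt-inject₁ j = cong₂ _∷_
    (trans (replacement-above (x ∷ b) d (inject₁<fromℕ j)) (at-fromℕ x b))
    (Vec.tabulate-cong λ i → below (opposite i))
    where
    below : ∀ i → replacement (x ∷ b) d (inject₁ j) (inject₁ i) ≡ replacement b d j i
    below i with Fin.<-cmp j i
    ... | tri< j<i _ _ = trans (replacement-above (x ∷ b) d (inject₁-mono-< j<i))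
                           (trans (at-inject₁ x b i) (sym (replacement-above b d j<i)))
    ... | tri≈ _ refl _ = trans (replacement-same (x ∷ b) d (inject₁ i)) (sym (replacement-same b d i))
    ... | tri> _ _ i<j = trans (replacement-below (x ∷ b) d (inject₁-mono-< i<j))
                           (sym (replacement-below b d i<j))

-- The results of rules I to III, read from index l - 1 downwards: skip passes
-- the indices above the one to which rule I or II applies, and skipping all
-- of them is rule III.
infix 4 _⟶[_]_
data _⟶[_]_ : ∀ {l} → Seq l → ℕ → Seq l → Set where
  stop   : ∀ {d} → [] ⟶[ d ] []
  skip   : ∀ {l x d} {b c : Seq l} → All (d ≤_) x → b ⟶[ d ] c → x ∷ b ⟶[ d ] x ∷ c
  ruleI  : ∀ {l x d} {b : Seq l} → AllV (Any Even) b → x ∷ b ⟶[ d ] just d ∷ blanks l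
  ruleII : ∀ {l x d} {b : Seq l} → Any (_< d) x → x ∷ b ⟶[ d ] just d ∷ blanks l

module _ {l} {x : Entry} {b : Seq l} {d : ℕ} where

  atLeastAbove-inject₁⁻ : ∀ {j} → BlankOrAtLeastAbove (x ∷ b) d (inject₁ j) →
                          All (d ≤_) x × BlankOrAtLeastAbove b d j
  atLeastAbove-inject₁⁻ {j} above =
    subst (All (d ≤_)) (at-fromℕ x b) (above (fromℕ l) (inject₁<fromℕ j)) ,
    λ i j<i → subst (All (d ≤_)) (at-inject₁ x b i) (above (inject₁ i) (inject₁-mono-< j<i))

  atLeastAbove-inject₁⁺ : ∀ {j} → All (d ≤_) x → BlankOrAtLeastAbove b d j →
                          BlankOrAtLeastAbove (x ∷ b) d (inject₁ j)
  atLeastAbove-inject₁⁺ d≤x above i j<i with view i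
  ... | ‵fromℕ     = subst (All (d ≤_)) (sym (at-fromℕ x b)) d≤x
  ... | ‵inject₁ i = subst (All (d ≤_)) (sym (at-inject₁ x b i)) (above i (inject₁-cancel-< j<i))

rule⇒⟶ : ∀ {l} (b : Seq l) d j → RuleI b d j ⊎ RuleII b d j → b ⟶[ d ] replaceAt b d j
rule⇒⟶ (x ∷ b) d j r with view j
rule⇒⟶ (x ∷ b) d _ (inj₁ (evens , _)) | ‵fromℕ
  rewrite replaceAt-fromℕ x b d =
  ruleI (at-all⁻ λ i → subst (Any Even) (at-inject₁ x b i) (evens (inject₁ i) (inject₁<fromℕ i)))
rule⇒⟶ (x ∷ b) d _ (inj₂ (small , _)) | ‵fromℕ
  rewrite replaceAt-fromℕ x b d = ruleII (subst (Any (_< d)) (at-fromℕ x b) small)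
rule⇒⟶ (x ∷ b) d _ (inj₁ (evens , above)) | ‵inject₁ j
  rewrite replaceAt-inject₁ x b d j with atLeastAbove-inject₁⁻ above
... | d≤x , above′ = skip d≤x (rule⇒⟶ b d j (inj₁
  ((λ i i<j → subst (Any Even) (at-inject₁ x b i) (evens (inject₁ i) (inject₁-mono-< i<j))) , above′)))
rule⇒⟶ (x ∷ b) d _ (inj₂ (small , above)) | ‵inject₁ j
  rewrite replaceAt-inject₁ x b d j with atLeastAbove-inject₁⁻ above
... | d≤x , above′ = skip d≤x (rule⇒⟶ b d j (inj₂ (subst (Any (_< d)) (at-inject₁ x b j) small , above′)))

ruleIII⇒⟶ : ∀ {l} {b : Seq l} {d} → AllV (All (d ≤_)) b → b ⟶[ d ] b
ruleIII⇒⟶ []       = stop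
ruleIII⇒⟶ (p ∷ ps) = skip p (ruleIII⇒⟶ ps)

⟶⇒rule : ∀ {l} {b c : Seq l} {d} → b ⟶[ d ] c →
  (∃ λ j → (RuleI b d j ⊎ RuleII b d j) × c ≡ replaceAt b d j) ⊎ (RuleIII b d × c ≡ b)
⟶⇒rule stop = inj₂ ((λ ()) , refl)
⟶⇒rule (skip {x = x} {d} {b} {c} d≤x b⟶c) with ⟶⇒rule b⟶c
... | inj₂ (all , refl) = inj₂ (at-all⁺ {P = All (d ≤_)} (d≤x ∷ at-all⁻ all) , refl)
... | inj₁ (j , rule , refl) = inj₁
      ( inject₁ j
      , Sum.map (Product.map evens (atLeastAbove-inject₁⁺ d≤x))
                (Product.map (subst (Any (_< d)) (sym (at-inject₁ x b j))) (atLeastAbove-inject₁⁺ d≤x))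
                rule
      , sym (replaceAt-inject₁ x b d j))
  where
  evens : (∀ i → i Fin.< j → Any Even (at b i)) → ∀ i → i Fin.< inject₁ j → Any Even (at (x ∷ b) i)
  evens f i i<j with view i
  ... | ‵fromℕ     = contradiction i<j (fromℕ≮ _)
  ... | ‵inject₁ i = subst (Any Even) (sym (at-inject₁ x b i)) (f i (inject₁-cancel-< i<j))
⟶⇒rule (ruleI {l} {x} {d} {b} evens) = inj₁
  ( fromℕ l
  , inj₁ (below , λ i top<i → contradiction top<i (fromℕ≮ i))
  , sym (replaceAt-fromℕ x b d))
  where
  below : ∀ i → i Fin.< fromℕ l → Any Even (at (x ∷ b) i)
  below i i<top with view i
  ... | ‵fromℕ     = contradiction i<top (fromℕ≮ _)
  ... | ‵inject₁ i = subst (Any Even) (sym (at-inject₁ x b i)) (at-all⁺ evens i)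
⟶⇒rule (ruleII {l} {x} {d} {b} small) = inj₁
  ( fromℕ l
  , inj₂ (subst (Any (_< d)) (sym (at-fromℕ x b)) small , λ i top<i → contradiction top<i (fromℕ≮ i))
  , sym (replaceAt-fromℕ x b d))

module _ {l} {b c : Seq l} {d : ℕ} where

  private
    applicable? : ∀ j → Dec (RuleI b d j ⊎ RuleII b d j)
    applicable? j = ruleI? b d j ⊎-dec ruleII? b d j

  ∈-candidates⁺ : b ⟶[ d ] c → c ∈ candidates b d
  ∈-candidates⁺ b⟶c with ⟶⇒rule b⟶c
  ... | inj₁ (j , rule , refl) =
    ∈.∈-++⁺ˡ (∈.∈-map⁺ (replaceAt b d) (∈.∈-filter⁺ applicable? (∈.∈-allFin j) rule))
  ... | inj₂ (rule , refl) =
    ∈.∈-++⁺ʳ (List.map (replaceAt b d) (filter applicable? (allFin l)))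
             (∈.∈-filter⁺ (λ c → ruleIII? c d) (here refl) rule)

  ∈-candidates⁻ : c ∈ candidates b d → b ⟶[ d ] c
  ∈-candidates⁻ c∈ with ∈.∈-++⁻ (List.map (replaceAt b d) (filter applicable? (allFin l))) c∈
  ... | inj₁ c∈ˡ with ∈.∈-map⁻ (replaceAt b d) c∈ˡ
  ...   | j , j∈ , refl = rule⇒⟶ b d j (proj₂ (∈.∈-filter⁻ applicable? {xs = allFin l} j∈))
  ∈-candidates⁻ c∈ | inj₂ c∈ʳ with ∈.∈-filter⁻ (λ c → ruleIII? c d) {xs = b ∷ []} c∈ʳ
  ... | here refl , rule = ruleIII⇒⟶ (at-all⁻ rule)

⟶-exists : ∀ {l} (b : Seq l) d → ∃ λ c → b ⟶[ d ] c
⟶-exists []            d = [] , stop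
⟶-exists (nothing ∷ b) d = _ , skip nothing (proj₂ (⟶-exists b d))
⟶-exists (just x ∷ b)  d with d ℕ.≤? x
... | yes d≤x = _ , skip (just d≤x) (proj₂ (⟶-exists b d))
... | no  d≰x = _ , ruleII (just (ℕ.≰⇒> d≰x))

infix 4 _≤ₛ_
_≤ₛ_ : ∀ {l} → Seq l → Seq l → Set
_≤ₛ_ {l} = DecTotalOrder._≤_ (seqOrder l)

module _ {l} (b : Seq l) (d : ℕ) where
  private module Max = Extrema (DecTotalOrder.totalOrder (seqOrder l))

  -- The first alternative is the default of `max`; the blank sequence satisfies every invariant
  -- proved through this lemma.
  rawUpdate-⟶ : rawUpdate b d ≡ blanks l ⊎ b ⟶[ d ] rawUpdate b d
  rawUpdate-⟶ = Sum.map₂ ∈-candidates⁻ (Max.argmax-sel (λ c → c) (blanks l) (candidates b d))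

  ⟶-≤-rawUpdate : ∀ {c} → b ⟶[ d ] c → c ≤ₛ rawUpdate b d
  ⟶-≤-rawUpdate b⟶c = LAll.lookup (Max.xs≤max (blanks l) (candidates b d)) (∈-candidates⁺ b⟶c)

-- Values and decreasing sequences by recursion on the vector

sum-tabulate-top : ∀ {l} (f : Fin (suc l) → ℕ) →
  sum (List.tabulate f) ≡ f (fromℕ l) + sum (List.tabulate (f ∘ inject₁))
sum-tabulate-top {zero}  f = refl
sum-tabulate-top {suc l} f = begin
  f₀ + sum (List.tabulate (f ∘ Fin.suc))  ≡⟨ cong (f₀ +_) (sum-tabulate-top (f ∘ Fin.suc)) ⟩
  f₀ + (top + rest)                       ≡⟨ ℕ.+-assoc f₀ top rest ⟨
  f₀ + top + rest                         ≡⟨ cong (_+ rest) (ℕ.+-comm f₀ top) ⟩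
  top + f₀ + rest                         ≡⟨ ℕ.+-assoc top f₀ rest ⟩
  top + (f₀ + rest)                       ∎
  where
  open ≡-Reasoning
  f₀ = f Fin.zero
  top = f (fromℕ (suc l))
  rest = sum (List.tabulate (f ∘ Fin.suc ∘ inject₁))

sum-filter-tabulate : ∀ {A : Set} {P : Pred A 0ℓ} (P? : Decidable P) (h : A → ℕ) {l} (g : Fin l → A) →
  sum (List.map h (filter P? (List.tabulate g)))
    ≡ sum (List.tabulate λ i → if does (P? (g i)) then h (g i) else 0)
sum-filter-tabulate P? h {zero}  g = refl
sum-filter-tabulate P? h {suc l} g with P? (g Fin.zero)
... | yes _ = cong (h (g Fin.zero) +_) (sum-filter-tabulate P? h (g ∘ Fin.suc))
... | no  _ = sum-filter-tabulate P? h (g ∘ Fin.suc)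

weight : Entry → ℕ → ℕ
weight x i = if does (MAny.dec even? x) then 2 ^ i else 0

-- The head carries the highest index, whereas `List.tabulate` unfolds at the lowest;
-- `sum-tabulate-top` bridges the two.
value-∷ : ∀ {l} x (b : Seq l) → value (x ∷ b) ≡ weight x l + value b
value-∷ {l} x b = begin
  value (x ∷ b)
    ≡⟨ as-sum (x ∷ b) ⟩
  sum (List.tabulate λ i → weight (at (x ∷ b) i) (toℕ i))
    ≡⟨ sum-tabulate-top (λ i → weight (at (x ∷ b) i) (toℕ i)) ⟩
  weight (at (x ∷ b) (fromℕ l)) (toℕ (fromℕ l))
    + sum (List.tabulate λ i → weight (at (x ∷ b) (inject₁ i)) (toℕ (inject₁ i)))
    ≡⟨ cong₂ _+_ (cong₂ weight (at-fromℕ x b) (Fin.toℕ-fromℕ l))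
        (cong sum (List.tabulate-cong λ i → cong₂ weight (at-inject₁ x b i) (Fin.toℕ-inject₁ i))) ⟩
  weight x l + sum (List.tabulate λ i → weight (at b i) (toℕ i))
    ≡⟨ cong (weight x l +_) (as-sum b) ⟨
  weight x l + value b ∎
  where
  open ≡-Reasoning
  as-sum : ∀ {l} (b : Seq l) → value b ≡ sum (List.tabulate λ i → weight (at b i) (toℕ i))
  as-sum b = sum-filter-tabulate (λ i → MAny.dec even? (at b i)) (λ i → 2 ^ toℕ i) (λ i → i)

decreasing-∷⁻ : ∀ {l x} {b : Seq l} → Decreasing (x ∷ b) →
  AllV (λ y → All (λ u → All (_≤ u) y) x) b × Decreasing b
decreasing-∷⁻ {l} {x} {b} dec =
    at-all⁻ (λ j → subst₂ (λ x y → All (λ u → All (_≤ u) y) x) (at-fromℕ x b) (at-inject₁ x b j)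
                   (dec (fromℕ l) (inject₁ j) (inject₁<fromℕ j)))
  , λ i j j<i → subst₂ (λ x y → All (λ u → All (_≤ u) y) x) (at-inject₁ x b i) (at-inject₁ x b j)
                   (dec (inject₁ i) (inject₁ j) (inject₁-mono-< j<i))

decreasing-∷⁺ : ∀ {l x} {b : Seq l} → AllV (λ y → All (λ u → All (_≤ u) y) x) b →
  Decreasing b → Decreasing (x ∷ b)
decreasing-∷⁺ {l} {x} {b} below dec i j j<i with view i | view j
... | ‵fromℕ     | ‵fromℕ     = contradiction j<i (fromℕ≮ _)
... | ‵fromℕ     | ‵inject₁ j rewrite at-fromℕ x b | at-inject₁ x b j = at-all⁺ below j
... | ‵inject₁ i | ‵fromℕ     = contradiction j<i (fromℕ≮ _)
... | ‵inject₁ i | ‵inject₁ j rewrite at-inject₁ x b i | at-inject₁ x b j =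
  dec i j (inject₁-cancel-< j<i)

blanks-decreasing : ∀ l → Decreasing (blanks l)
blanks-decreasing zero    = λ ()
blanks-decreasing (suc l) = decreasing-∷⁺ (blanks-all nothing) (blanks-decreasing l)

just-blanks-decreasing : ∀ {l x} → Decreasing (x ∷ blanks l)
just-blanks-decreasing {x = x} = decreasing-∷⁺ (blanks-all (const-nothing x)) (blanks-decreasing _)
  where
  const-nothing : ∀ x → All (λ u → All (_≤ u) nothing) x
  const-nothing nothing  = nothing
  const-nothing (just _) = just nothing

⟶-all : ∀ {P : Entry → Set} {l} {b c : Seq l} {d} → P nothing → P (just d) →
        b ⟶[ d ] c → AllV P b → AllV P c
⟶-all p₀ pd stop         []       = []
⟶-all p₀ pd (skip _ b⟶c) (p ∷ ps) = p ∷ ⟶-all p₀ pd b⟶c ps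
⟶-all p₀ pd (ruleI _)    _        = pd ∷ blanks-all p₀
⟶-all p₀ pd (ruleII _)   _        = pd ∷ blanks-all p₀

⟶-decreasing : ∀ {l} {b c : Seq l} {d} → b ⟶[ d ] c → Decreasing b → Decreasing c
⟶-decreasing stop dec = dec
⟶-decreasing (skip {x = x} d≤x b⟶c) dec with decreasing-∷⁻ dec
-- A skipped entry is blank or at least d, so it also bounds the d that may be written below it.
... | below , dec′ = decreasing-∷⁺
  (⟶-all (MAll.map (λ _ → nothing) d≤x) (MAll.map just d≤x) b⟶c below) (⟶-decreasing b⟶c dec′)
⟶-decreasing (ruleI _)  _ = just-blanks-decreasing
⟶-decreasing (ruleII _) _ = just-blanks-decreasing

-- Soundness of basic updates

weight-even : ∀ {d} → Even d → ∀ i → weight (just d) i ≡ 2 ^ i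
weight-even {d} e i rewrite dec-true (MAny.dec even? (just d)) (just e) = refl

weight-odd : ∀ {d} → Odd d → ∀ i → weight (just d) i ≡ 0
weight-odd {d} o i rewrite dec-false (MAny.dec even? (just d)) (λ { (just e) → o e }) = refl

value-evens : ∀ {l} {b : Seq l} → AllV (Any Even) b → value b ≡ 2 ^ l ∸ 1
value-evens [] = refl
value-evens {suc l} {just d ∷ b} (just e ∷ es) = begin
  value (just d ∷ b)               ≡⟨ value-∷ (just d) b ⟩
  weight (just d) l + value b      ≡⟨ cong₂ _+_ (weight-even e l) (value-evens es) ⟩
  2 ^ l + (2 ^ l ∸ 1)              ≡⟨ ℕ.+-∸-assoc (2 ^ l) (ℕ.m^n>0 2 l) ⟨
  2 ^ l + 2 ^ l ∸ 1                ≡⟨ cong (λ k → 2 ^ l + k ∸ 1) (ℕ.+-identityʳ (2 ^ l)) ⟨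
  2 ^ suc l ∸ 1                    ∎
  where open ≡-Reasoning

n≤2^⌈log2⌉n : ∀ n (a : Acc _<_ n) → n ≤ 2 ^ ⌈log2⌉ n a
n≤2^⌈log2⌉n 0 _ = z≤n
n≤2^⌈log2⌉n 1 _ = ℕ.≤-refl
n≤2^⌈log2⌉n (suc (suc n)) (acc rs) = begin
  2 + n                       ≡⟨ cong (2 +_) (ℕ.⌊n/2⌋+⌈n/2⌉≡n n) ⟨
  2 + (⌊ n /2⌋ + ⌈ n /2⌉)      ≤⟨ ℕ.+-monoʳ-≤ 2 (ℕ.+-monoˡ-≤ ⌈ n /2⌉ (ℕ.⌊n/2⌋≤⌈n/2⌉ n)) ⟩
  2 + (⌈ n /2⌉ + ⌈ n /2⌉)      ≡⟨ cong suc (ℕ.+-suc ⌈ n /2⌉ ⌈ n /2⌉) ⟨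
  suc ⌈ n /2⌉ + suc ⌈ n /2⌉    ≡⟨ cong (suc ⌈ n /2⌉ +_) (ℕ.+-identityʳ _) ⟨
  2 * suc ⌈ n /2⌉             ≤⟨ ℕ.*-monoʳ-≤ 2 (n≤2^⌈log2⌉n (suc ⌈ n /2⌉) _) ⟩
  _                           ∎
  where open ℕ.≤-Reasoning

-- For n = e + 1 this makes `2 ^ len`, the worth of a carry, exceed e.
n≤2^⌈log₂n⌉ : ∀ n → n ≤ 2 ^ ⌈log₂ n ⌉
n≤2^⌈log₂n⌉ n = n≤2^⌈log2⌉n n (<-wellFounded n)

Even-⊔ : ∀ {c d} → Even c → Even d → Even (c ⊔ d)
Even-⊔ {c} {d} ec ed with ℕ.⊔-sel c d
... | inj₁ eq = subst Even (sym eq) ec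
... | inj₂ eq = subst Even (sym eq) ed

lookup-AllPairs : ∀ {A : Set} {T : A → A → Set} {xs} → AllPairs T xs → ∀ {i j} → i Fin.< j →
                  T (List.lookup xs i) (List.lookup xs j)
lookup-AllPairs (ps ∷ _) {Fin.zero}  {Fin.suc j} _         = LAll.lookup ps (∈.∈-lookup j)
lookup-AllPairs (_ ∷ ps) {Fin.suc i} {Fin.suc j} (s≤s i<j) = lookup-AllPairs ps i<j

module UpView (G : ParityGame) where
  open ParityGame G
  open UpdateGames G

  data UpView (b : Seq len) (v : Vertex) : Witness → Set where
    carried  : Carry b (φ v) → UpView b v ⊤⁺
    overflow : e < value (rawUpdate b (φ v)) → UpView b v ⊤⁺
    fits     : ¬ Carry b (φ v) → value (rawUpdate b (φ v)) ≤ e → UpView b v [ rawUpdate b (φ v) ]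

  up-view : ∀ b v → UpView b v (up [ b ] v)
  up-view b v = choose (carry? b (φ v)) (value (rawUpdate b (φ v)) ℕ.≤? e)
    where
    choose : (C? : Dec (Carry b (φ v))) (F? : Dec (value (rawUpdate b (φ v)) ≤ e)) →
      UpView b v (if does C? then ⊤⁺ else if does F? then [ rawUpdate b (φ v) ] else ⊤⁺)
    choose (yes c) _       = carried c
    choose (no ¬c) (yes f) = fits ¬c f
    choose (no _)  (no ¬f) = overflow (ℕ.≰⇒> ¬f)

module Soundness (G : ParityGame) (R : ParityGame.Vertex G → ParityGame.Vertex G → Set) where
  open ParityGame G
  open UpdateGames G
  open UpView G

  private
    W = Walk φ R

    recolour : ∀ {c c′ x y} → c ≡ c′ → W c x y → W c′ x y
    recolour refl w = w

    absorb : ∀ {a b} c → b ≤ a → a ⊔ (b ⊔ c) ≡ a ⊔ c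
    absorb {a} {b} c b≤a = trans (sym (ℕ.⊔-assoc a b c)) (cong (_⊔ c) (ℕ.m≥n⇒m⊔n≡m b≤a))

  -- The largest colour is that of an end, so a hop between vertices of even colour has an even
  -- maximum, and so do composites of such hops.
  Hop : Vertex → Vertex → Set
  Hop x y = W (φ x ⊔ φ y) x y

  -- Here `nothing` stands for a missing vertex: no higher entry, or a chain that has no vertex yet.
  After Ruled AtLeast : Maybe Vertex → Vertex → Set
  After nothing  z = ⊤
  After (just x) z = Hop x z
  Ruled nothing  z = ⊤
  Ruled (just x) z = W (φ x) x z
  AtLeast nothing  z = ⊤
  AtLeast (just x) z = φ z ≤ φ x

  Next : Maybe Vertex → Vertex → Set
  Next nothing  v = ⊤
  Next (just y) v = R y v

  Dom : Vertex → Maybe Vertex → Set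
  Dom z nothing  = ⊥
  Dom z (just y) = z ≡ y ⊎ W (φ z) z y

  Dom? : Maybe Vertex → Maybe Vertex → Set
  Dom? nothing  y = ⊤
  Dom? (just z) y = Dom z y

  -- The start x is not counted, so chains that share a vertex compose with lengths added.
  data Chain (x : Maybe Vertex) : ℕ → Maybe Vertex → Set where
    []  : Chain x 0 x
    _▷_ : ∀ {m y z} → Chain x m y → Even (φ z) × After y z → Chain x (suc m) (just z)

  Link : Maybe Vertex → ℕ → Vertex → Set
  Link x m z = ∃ λ y → Chain x m y × After y z

  _++ᶜ_ : ∀ {x y z m m′} → Chain x m y → Chain y m′ z → Chain x (m′ + m) z
  c ++ᶜ []       = c
  c ++ᶜ (c′ ▷ p) = (c ++ᶜ c′) ▷ p

  -- An entry d at index l stands for 2 ^ l successive vertices, all even except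
  -- possibly the last one, z, which has colour d.  Here y is the current vertex
  -- and x the last vertex for the next higher entry (nothing if there is none);
  -- Ruled and Dom say that no colour above φ x or d has been seen since.
  Inv : Maybe Vertex → ∀ {l} → Seq l → Maybe Vertex → Set
  Inv x []                   y = ⊤
  Inv x (nothing ∷ b)        y = Inv x b y
  Inv x (_∷_ {l} (just d) b) y = ∃ λ z →
    Link x (2 ^ l ∸ 1) z × φ z ≡ d × Ruled x z × Dom z y × Inv (just z) b y

  ruled-hop : ∀ x {z w} → Ruled x z → Hop z w → After x w
  ruled-hop nothing  _ _ = tt
  ruled-hop (just x) {z} {w} r h = recolour (absorb (φ w) (target≤ r)) (r ◅◅ h)

  ruled-trans : ∀ x {z w} → Ruled x z → W (φ z) z w → Ruled x w
  ruled-trans nothing  _ _ = tt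
  ruled-trans (just x) r r′ = recolour (ℕ.m≥n⇒m⊔n≡m (target≤ r)) (r ◅◅ r′)

  dom-hop : ∀ {z y v} → Dom z y → Next y v → Hop z v
  dom-hop {y = just y} (inj₁ refl) r = [ r ]
  dom-hop {y = just y} {v} (inj₂ w) r = recolour (absorb (φ v) (target≤ w)) (w ◅◅ [ r ])

  dom-after : ∀ x {y v} → Dom? x y → Next y v → After x v
  dom-after nothing  _ _ = tt
  dom-after (just x) d r = dom-hop d r

  dom-ruled : ∀ x {y v} → Dom? x y → Next y v → AtLeast x v → Ruled x v
  dom-ruled nothing  _ _ _ = tt
  dom-ruled (just x) d r v≤x = recolour (ℕ.m≥n⇒m⊔n≡m v≤x) (dom-hop d r)

  -- This serves rule II: the last vertex z of an entry gives way to a vertex v of larger colour,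
  -- and passing through z does not raise the maximum over the new ends.
  after-replace : ∀ x {z v} → After x z → Hop z v → φ z ≤ φ v → After x v
  after-replace nothing  _ _ _ = tt
  after-replace (just x) {z} {v} a h z≤v = recolour eq (a ◅◅ h)
    where
    eq : (φ x ⊔ φ z) ⊔ (φ z ⊔ φ v) ≡ φ x ⊔ φ v
    eq rewrite ℕ.m≤n⇒m⊔n≡n z≤v | ℕ.⊔-assoc (φ x) (φ z) (φ v) | ℕ.m≤n⇒m⊔n≡n z≤v = refl

  -- When the entry ending in z is bypassed, the first hop out of z is prolonged backwards to x;
  -- this is possible because the walk from x to z has no colour above `φ x`.
  link-skip : ∀ x {z m w} → Ruled x z → Link (just z) m w → Link x m w
  link-skip x r (_ , [] , h) = x , [] , ruled-hop x r h
  link-skip x r (_ , c ▷ (e , a) , h) with link-skip x r (_ , c , a)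
  ... | _ , c′ , a′ = _ , c′ ▷ (e , a′) , h

  inv-skip : ∀ x {z l} (b : Seq l) {y} → Ruled x z → Inv (just z) b y → Inv x b y
  inv-skip x []            r _ = tt
  inv-skip x (nothing ∷ b) r i = inv-skip x b r i
  inv-skip x (just d ∷ b)  r (z , link , eq , ruled , rest) =
    z , link-skip x r link , eq , ruled-trans x r ruled , rest

  inv-tail : ∀ x {l} x₀ (b : Seq l) {y} → Inv x (x₀ ∷ b) y → Inv x b y
  inv-tail x nothing  b i = i
  inv-tail x (just d) b (z , _ , _ , ruled , _ , i) = inv-skip x b ruled i

  inv-blanks : ∀ {x y} l → Inv x (blanks l) y
  inv-blanks zero    = tt
  inv-blanks (suc l) = inv-blanks l

  -- Chains of the even entries are joined from the highest downwards, and odd entries are bypassed.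
  -- An even entry at index l contributes the `2 ^ l ∸ 1` vertices of its link and its last vertex.
  value-chain : ∀ {x l} (b : Seq l) {y} → Inv x b y → Dom? x y → ∃ λ a → Chain x (value b) a × Dom? a y
  value-chain [] _ d = _ , [] , d
  value-chain (nothing ∷ b) i d rewrite value-∷ nothing b = value-chain b i d
  value-chain {x} (_∷_ {l} (just c) b) (z , (_ , ch , a) , refl , r , dz , i) d with even? (φ z)
  ... | yes ev rewrite value-∷ (just (φ z)) b | weight-even ev l with value-chain b i dz
  ...   | u , ch′ , du = u , subst (λ k → Chain x k u) eq ((ch ▷ (ev , a)) ++ᶜ ch′) , du
    where
    eq : value b + suc (2 ^ l ∸ 1) ≡ 2 ^ l + value b
    eq = trans (cong (value b +_) (ℕ.m+[n∸m]≡n (ℕ.m^n>0 2 l))) (ℕ.+-comm (value b) (2 ^ l))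
  value-chain {x} (_∷_ {l} (just c) b) (z , (_ , ch , a) , refl , r , dz , i) d | no od
    rewrite value-∷ (just (φ z)) b | weight-odd od l = value-chain b (inv-skip x b r i) d

  -- Rule I as a binary increment: l even entries have value `2 ^ l ∸ 1`, exactly the chain that an
  -- entry at index l requires before its last vertex v.
  evens-link : ∀ {x l} (b : Seq l) {y v} → AllV (Any Even) b → Inv x b y → Dom? x y → Next y v →
               Link x (2 ^ l ∸ 1) v
  evens-link b es i d r with value-chain b i d
  ... | a , ch , da = a , subst (λ k → Chain _ k a) (value-evens es) ch , dom-after a da r

  inv-step : ∀ x {l} {b c : Seq l} {y v} → b ⟶[ φ v ] c → Dom? x y → AtLeast x v → Next y v →
             Inv x b y → Inv x c (just v)
  inv-step x stop _ _ _ _ = tt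
  inv-step x (skip nothing s) d l r i = inv-step x s d l r i
  inv-step x (skip (just v≤c) s) d l r (z , link , refl , ruled , dz , i) =
    z , link , refl , ruled , inj₂ (dom-ruled (just z) dz r v≤c) , inv-step (just z) s dz v≤c r i
  -- Rule I overwrites `x₀`, so its link is bypassed before the entries below are joined.
  inv-step x (ruleI {l} {x₀} {b = b} es) d v≤x r i =
    _ , evens-link b es (inv-tail x x₀ b i) d r , refl , dom-ruled x d r v≤x , inj₁ refl , inv-blanks l
  inv-step x (ruleII {l} {b = b} (just c<v)) d v≤x r (z , (u , ch , a) , refl , _ , dz , _) =
    _ , (u , ch , after-replace u a (dom-hop dz r) (ℕ.<⇒≤ c<v)) , refl
      , dom-ruled x d r v≤x , inj₁ refl , inv-blanks l

  inv-rawUpdate : ∀ {l} (b : Seq l) {y v} → Next y v → Inv nothing b y →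
                  Inv nothing (rawUpdate b (φ v)) (just v)
  inv-rawUpdate {l} b {v = v} r i = go (rawUpdate-⟶ b (φ v))
    where
    go : ∀ {c} → c ≡ blanks l ⊎ b ⟶[ φ v ] c → Inv nothing c (just v)
    go (inj₁ refl) = inv-blanks l
    go (inj₂ s)    = inv-step nothing s tt tt r i

  carry-chain : ∀ {l} (b : Seq l) {y v} → Carry b (φ v) → Inv nothing b y → Next y v →
                Chain nothing (2 ^ l) (just v)
  carry-chain {l} b {v = v} (ev , es) i r with evens-link b (at-all⁻ es) i tt r
  ... | _ , ch , h = subst (λ k → Chain nothing k (just v)) (ℕ.m+[n∸m]≡n (ℕ.m^n>0 2 l)) (ch ▷ (ev , h))

  LongChain : Set
  LongChain = ∃₂ λ m a → e < m × Chain nothing m a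

  data Path : Maybe Vertex → List Vertex → Set where
    []  : ∀ {y} → Path y []
    _∷_ : ∀ {y v w} → Next y v → Path (just v) w → Path y (v ∷ w)

  won-stays : ∀ w → foldl up ⊤⁺ w ≡ ⊤⁺
  won-stays []      = refl
  won-stays (_ ∷ w) = won-stays w

  won⇒long-chain : ∀ {y} b w → Path y w → Inv nothing b y → foldl up [ b ] w ≡ ⊤⁺ → LongChain
  won⇒long-chain b (v ∷ w) (r ∷ path) i won = go (up-view b v) won
    where
    go : ∀ {s} → UpView b v s → foldl up s w ≡ ⊤⁺ → LongChain
    go (carried c) _ = 2 ^ len , just v , n≤2^⌈log₂n⌉ (suc e) , carry-chain b c i r
    go (overflow e<v) _ = let a , ch , _ = value-chain (rawUpdate b (φ v)) (inv-rawUpdate b r i) tt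
                          in _ , a , e<v , ch
    go (fits _ _) won = won⇒long-chain (rawUpdate b (φ v)) w path (inv-rawUpdate b r i) won

  EvenWalk : Vertex → Vertex → Set
  EvenWalk x y = ∃ λ c → Even c × W c x y

  -- The list has the latest vertex in front, which is why `EvenWalk` appears flipped.
  chain-vertices : ∀ {m a} → Chain nothing m a → ∃ λ zs →
    length zs ≡ m × LAll.All (Even ∘ φ) zs × Linked (flip EvenWalk) zs × head zs ≡ a
  chain-vertices [] = [] , refl , LAll.[] , [] , refl
  chain-vertices (ch ▷ (ev , a)) with chain-vertices ch
  ... | [] , len≡ , _ , _ , refl = _ , cong suc len≡ , ev LAll.∷ LAll.[] , [-] , refl
  ... | z ∷ zs , len≡ , ez LAll.∷ es , linked , refl =
    _ , cong suc len≡ , ev LAll.∷ ez LAll.∷ es , (_ , Even-⊔ ez ev , a) ∷ linked , refl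

  long-chain⇒cycle : LongChain → ∃ λ x → EvenWalk x x
  long-chain⇒cycle (m , a , e<m , ch) with chain-vertices ch
  ... | zs , refl , es , linked , _ = cycle
    where
    evens = filter (even? ∘ φ) (allFin n)
    z : Fin (length zs) → Vertex
    z = List.lookup zs
    z∈ : ∀ i → z i ∈ evens
    z∈ i = ∈.∈-filter⁺ (even? ∘ φ) (∈.∈-allFin (z i)) (LAll.lookup es (∈.∈-lookup i))
    cycle : ∃ λ x → EvenWalk x x
    -- By definition e is the length of `evens`, so the more than e chain vertices cannot all have
    -- different indices there.
    cycle with Fin.pigeonhole e<m (LAny.index ∘ z∈)
    ... | i , j , i<j , eq = z j , subst (EvenWalk (z j)) zi≡zj
          (lookup-AllPairs (Linked.Linked⇒AllPairs (flip trans-even) linked) i<j)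
      where
      trans-even : ∀ {x y z} → EvenWalk x y → EvenWalk y z → EvenWalk x z
      trans-even (_ , e₁ , w₁) (_ , e₂ , w₂) = _ , Even-⊔ e₁ e₂ , w₁ ◅◅ w₂
      zi≡zj : z i ≡ z j
      zi≡zj = trans (LAny.lookup-index (z∈ i)) (trans (cong (List.lookup evens) eq) (sym (LAny.lookup-index (z∈ j))))

  linked⇒path : ∀ {w} → Linked R w → Path nothing w
  linked⇒path []      = []
  linked⇒path [-]     = tt ∷ []
  linked⇒path (r ∷ l) with linked⇒path l
  ... | _ ∷ path = tt ∷ r ∷ path

  won⇒even-cycle : ∀ {w} → Linked R w → foldl up [ blanks len ] w ≡ ⊤⁺ → ∃ λ x → EvenWalk x x
  won⇒even-cycle {w} l won =
    long-chain⇒cycle (won⇒long-chain (blanks len) w (linked⇒path l) (inv-blanks len) won)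

-- Words without odd cycles

linked-++⁻ˡ : ∀ {A : Set} {R : A → A → Set} u {w} → Linked R (u ++ w) → Linked R u
linked-++⁻ˡ []          _       = []
linked-++⁻ˡ (x ∷ [])    _       = [-]
linked-++⁻ˡ (x ∷ y ∷ u) (r ∷ l) = r ∷ linked-++⁻ˡ (y ∷ u) l

linked-++⁻ʳ : ∀ {A : Set} {R : A → A → Set} u {w} → Linked R (u ++ w) → Linked R w
linked-++⁻ʳ []      l = l
linked-++⁻ʳ (x ∷ u) l = linked-++⁻ʳ u (Linked.tail l)

-- The counting argument for an arbitrary machine. It is applied to `au` on `𝕎`, with `Φ d` the code
-- of the order at level d and M the code of `won`.
module LongWords
  {n} (φ : Fin n → ℕ) (R : Fin n → Fin n → Set)
  (even-cycles : ∀ {c x} → Walk φ R c x x → Even c)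
  {S : Set} (step : S → Fin n → S) (won : S) (Ok : S → Set)
  (step-won : ∀ v → step won v ≡ won)
  (step-ok : ∀ {s} v → Ok s → Ok (step s v))
  (M : ℕ) (Φ : ℕ → S → ℕ)
  (Φ-full : ∀ d {s} → Ok s → M ≤ Φ d s → s ≡ won)
  (Φ-mono : ∀ d {s} v → Ok s → φ v < d → Φ d s ≤ Φ d (step s v))
  (Φ-inc  : ∀ d {s} v → Ok s → Even d → φ v ≡ d → s ≡ won ⊎ Φ d s < Φ d (step s v))
  where

  Below : ℕ → List (Fin n) → Set
  Below d = LAll.All (λ v → φ v < d)

  run-won : ∀ w → foldl step won w ≡ won
  run-won []      = refl
  run-won (v ∷ w) = trans (cong (λ s → foldl step s w) (step-won v)) (run-won w)

  run-ok : ∀ {s} w → Ok s → Ok (foldl step s w)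
  run-ok []      ok = ok
  run-ok (v ∷ w) ok = run-ok w (step-ok v ok)

  Φ-mono* : ∀ {d s w} → Ok s → Below d w → Φ d s ≤ Φ d (foldl step s w)
  Φ-mono* ok LAll.[]       = ℕ.≤-refl
  Φ-mono* {w = v ∷ _} ok (v<d LAll.∷ ps) = ℕ.≤-trans (Φ-mono _ v ok v<d) (Φ-mono* (step-ok v ok) ps)

  data Scan (d L : ℕ) : List (Fin n) → Set where
    none  : ∀ u w → length u ≡ L → Below d u → Scan d L (u ++ w)
    first : ∀ u v w → length u < L → Below d u → φ v ≡ d → Scan d L (u ++ v ∷ w)

  scan : ∀ d L {w} → L ≤ length w → Below (suc d) w → Scan d L w
  scan d zero    {w}     _         _ = none [] w refl LAll.[]
  scan d (suc L) {v ∷ w} (s≤s L≤w) (v<1+d LAll.∷ ps) with φ v ℕ.≟ d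
  ... | yes eq = first [] v w z<s LAll.[] eq
  ... | no neq with scan d L L≤w ps
  ...   | none u w len≡ below      = none (v ∷ u) w (cong suc len≡) (v<d LAll.∷ below)
    where v<d = ℕ.≤∧≢⇒< (ℕ.≤-pred v<1+d) neq
  ...   | first u v′ w len< below eq = first (v ∷ u) v′ w (s<s len<) (v<d LAll.∷ below) eq
    where v<d = ℕ.≤∧≢⇒< (ℕ.≤-pred v<1+d) neq

  Forced : ℕ → ℕ → Set
  Forced d L = ∀ {s w} → Ok s → Linked R w → Below d w → L ≤ length w → foldl step s w ≡ won

  -- Between two vertices of the top colour d, and after the last one, there
  -- are fewer than L vertices; a budget bounds the number of occurrences of d.
  module _ {d L} (shorter : Forced d L) (Budget : ℕ → S → List (Fin n) → Set)
    (spend : ∀ {m s u v w} → Ok s → Linked R (v ∷ w) → Below d u → φ v ≡ d →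
             Budget m s (u ++ v ∷ w) →
             step (foldl step s u) v ≡ won ⊎
             ∃ λ m′ → m ≡ suc m′ × Budget m′ (step (foldl step s u) v) w)
    where

    -- Each permitted occurrence of d is allotted `suc L` vertices, enough for itself and those
    -- before it; the last L vertices suffice for `shorter`.
    budget : ℕ → ℕ
    budget m = m * suc L + L

    exhaust : ∀ m {s w} → Budget m s w → Ok s → Linked R w → Below (suc d) w →
              budget m ≤ length w → foldl step s w ≡ won
    exhaust m {s} b ok l below long with scan d L (ℕ.≤-trans (ℕ.m≤n+m L (m * suc L)) long) below
    ... | none u w len≡ below′ = begin
      foldl step s (u ++ w)           ≡⟨ List.foldl-++ step s u w ⟩
      foldl step (foldl step s u) w   ≡⟨ cong (λ s → foldl step s w)
                                          (shorter ok (linked-++⁻ˡ u l) below′ (ℕ.≤-reflexive (sym len≡))) ⟩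
      foldl step won w                ≡⟨ run-won w ⟩
      won                             ∎
      where open ≡-Reasoning
    ... | first u v w len< below′ eq =
      trans (List.foldl-++ step s u (v ∷ w)) (rest (spend ok (linked-++⁻ʳ u l) below′ eq b))
      where
      s′ = step (foldl step s u) v
      rest : s′ ≡ won ⊎ (∃ λ m′ → m ≡ suc m′ × Budget m′ s′ w) → foldl step s′ w ≡ won
      rest (inj₁ s′≡won) = trans (cong (λ s → foldl step s w) s′≡won) (run-won w)
      rest (inj₂ (m′ , refl , b′)) =
        exhaust m′ b′ (step-ok v (run-ok u ok)) (Linked.tail (linked-++⁻ʳ u l))
          (LAll.tail (LAll.++⁻ʳ u below)) (ℕ.+-cancelˡ-≤ (suc L) _ _ long′)
        where
        open ℕ.≤-Reasoning
        long′ : suc L + budget m′ ≤ suc L + length w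
        long′ = begin
          suc L + (m′ * suc L + L)   ≡⟨ ℕ.+-assoc (suc L) (m′ * suc L) L ⟨
          budget (suc m′)            ≤⟨ long ⟩
          length (u ++ v ∷ w)        ≡⟨ List.length-++ u ⟩
          length u + suc (length w)  ≡⟨ ℕ.+-suc (length u) (length w) ⟩
          suc (length u) + length w  ≤⟨ ℕ.+-monoˡ-≤ (length w) (ℕ.m≤n⇒m≤1+n len<) ⟩
          suc L + length w           ∎

  EvenBudget : ℕ → ℕ → S → List (Fin n) → Set
  EvenBudget d m s _ = M ≤ Φ d s + m

  -- Each d raises the potential, which does not fall in between. Once the budget is zero the
  -- potential has reached M, so the state is `won`.
  spend-even : ∀ {d} → Even d → ∀ {m s u v w} → Ok s → Linked R (v ∷ w) → Below d u → φ v ≡ d →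
    EvenBudget d m s (u ++ v ∷ w) →
    step (foldl step s u) v ≡ won ⊎
    ∃ λ m′ → m ≡ suc m′ × EvenBudget d m′ (step (foldl step s u) v) w
  spend-even {d} ev {m} {s} {u} {v} ok _ below eq b =
    go m b (Φ-inc d v (run-ok u ok) ev eq)
    where
    s′ = foldl step s u
    go : ∀ m → M ≤ Φ d s + m → s′ ≡ won ⊎ Φ d s′ < Φ d (step s′ v) →
         step s′ v ≡ won ⊎ ∃ λ m′ → m ≡ suc m′ × M ≤ Φ d (step s′ v) + m′
    go _ _ (inj₁ s′≡won) = inj₁ (trans (cong (λ s → step s v) s′≡won) (step-won v))
    go zero b (inj₂ _) = inj₁ (trans (cong (λ s → step s v) s′≡won) (step-won v))
      where
      s′≡won = Φ-full d (run-ok u ok) (ℕ.≤-trans (subst (M ≤_) (ℕ.+-identityʳ _) b) (Φ-mono* ok below))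
    go (suc m) b (inj₂ inc) = inj₂ (m , refl , (begin
      M                       ≤⟨ b ⟩
      Φ d s + suc m           ≡⟨ ℕ.+-suc (Φ d s) m ⟩
      suc (Φ d s) + m         ≤⟨ ℕ.+-monoˡ-≤ m (ℕ.≤-<-trans (Φ-mono* ok below) inc) ⟩
      Φ d (step s′ v) + m     ∎))
      where open ℕ.≤-Reasoning

  -- A second occurrence of a vertex of odd top colour would close an odd cycle.
  OddBudget : ℕ → ℕ → S → List (Fin n) → Set
  OddBudget d m _ w = LAll.All (λ v → φ v ≤ d) w ×
    ∃ λ fresh → length fresh ≤ m × (∀ {v} → v ∈ w → φ v ≡ d → v ∈ fresh)

  spend-odd : ∀ {d} → Odd d → ∀ {m s u v w} → Ok s → Linked R (v ∷ w) → Below d u → φ v ≡ d →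
    OddBudget d m s (u ++ v ∷ w) →
    step (foldl step s u) v ≡ won ⊎
    ∃ λ m′ → m ≡ suc m′ × OddBudget d m′ (step (foldl step s u) v) w
  spend-odd {d} od {m} {s} {u} {v} {w} ok l below eq (≤d , fresh , len≤ , covers) =
    inj₂ (go m (ℕ.≤-trans shrinks len≤))
    where
    other? : ∀ x → Dec (x ≢ v)
    other? x = ¬? (x Fin.≟ v)
    fresh′ = filter other? fresh
    shrinks : length fresh′ < length fresh
    shrinks = List.filter-notAll other? fresh
      (LAny.map (λ v≡x x≢v → x≢v (sym v≡x)) (covers (∈.∈-++⁺ʳ u (LAny.here refl)) eq))
    ≤d′ = LAll.++⁻ʳ u ≤d
    distinct : ∀ {x} → x ∈ w → x ≢ v
    distinct x∈w refl with list-walk l ≤d′ x∈w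
    ... | c , vv , c≤d =
      od (subst Even (ℕ.≤-antisym c≤d (subst (_≤ c) eq (source≤ vv))) (even-cycles vv))
    go : ∀ m → suc (length fresh′) ≤ m → ∃ λ m′ → m ≡ suc m′ × OddBudget d m′ (step (foldl step s u) v) w
    go (suc m) (s≤s len≤) = m , refl , LAll.tail ≤d′ , fresh′ , len≤ ,
      λ x∈w eq → ∈.∈-filter⁺ other? (covers (∈.∈-++⁺ʳ u (LAny.there x∈w)) eq) (distinct x∈w)

  -- Induction on the colour bound. The initial budget is M for even d, as the potential starts at 0
  -- or more, and n for odd d, when all vertices are fresh.
  forced : ∀ d → ∃ (Forced d)
  -- No word of length 1 or more has all its colours below 0.
  forced zero = 1 , λ { {w = v ∷ w} _ _ (() LAll.∷ _) _ }
  forced (suc d) with forced d | even? d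
  ... | L , shorter | yes ev = _ , λ ok l below →
    exhaust shorter (EvenBudget d) (spend-even ev) M (ℕ.m≤n+m M _) ok l below
  ... | L , shorter | no od = _ , λ ok l below →
    exhaust shorter (OddBudget d) (spend-odd od) n
      (LAll.map ℕ.≤-pred below , allFin n , ℕ.≤-reflexive (List.length-tabulate {n = n} (λ i → i)) , λ _ _ → ∈.∈-allFin _)
      ok l below

-- The order at level d, encoded in base B

module Potential (K d : ℕ) where

  -- Digits are 0 for blanks, 1 to K for odd entries from d on, K + 1 for entries below d, and at
  -- most 2 + K + K for the remaining even ones.
  B : ℕ
  B = 3 + K + K

  Bounded : ∀ {l} → Seq l → Set
  Bounded = AllV (All (_≤ K))

  -- Entries below d are identified because reading an even d turns them all
  -- into d; as odd entries have digits up to K, they rank above these.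
  digit : Entry → ℕ
  digit nothing = 0
  digit (just c) with c ℕ.<? d | even? c
  ... | yes _ | _     = suc K
  ... | no _  | yes _ = 2 + K + c
  ... | no _  | no _  = suc (K ∸ c)

  -- Ignoring what follows an entry below d keeps the code from falling when rule II replaces that
  -- entry by another colour below d and blanks the rest.
  remainder : Entry → ℕ → ℕ
  remainder nothing  r = r
  remainder (just c) r with c ℕ.<? d
  ... | yes _ = 0
  ... | no  _ = r

  Φ : ∀ {l} → Seq l → ℕ
  Φ []                = 0
  Φ (_∷_ {l} x b) = digit x * B ^ l + remainder x (Φ b)

  digit-small : ∀ {c} → c < d → digit (just c) ≡ suc K
  digit-small {c} c<d with c ℕ.<? d | even? c
  ... | yes _  | _ = refl
  ... | no c≮d | _ = contradiction c<d c≮d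

  digit-even : ∀ {c} → d ≤ c → Even c → digit (just c) ≡ 2 + K + c
  digit-even {c} d≤c ev with c ℕ.<? d | even? c
  ... | yes c<d | _      = contradiction d≤c (ℕ.<⇒≱ c<d)
  ... | no _    | yes _  = refl
  ... | no _    | no od  = contradiction ev od

  digit-odd : ∀ {c} → d ≤ c → Odd c → digit (just c) ≡ suc (K ∸ c)
  digit-odd {c} d≤c od with c ℕ.<? d | even? c
  ... | yes c<d | _      = contradiction d≤c (ℕ.<⇒≱ c<d)
  ... | no _    | yes ev = contradiction ev od
  ... | no _    | no _   = refl

  remainder-small : ∀ {c r} → c < d → remainder (just c) r ≡ 0
  remainder-small {c} c<d with c ℕ.<? d
  ... | yes _  = refl
  ... | no c≮d = contradiction c<d c≮d

  remainder-large : ∀ {c} → d ≤ c → ∀ r → remainder (just c) r ≡ r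
  remainder-large {c} d≤c r with c ℕ.<? d
  ... | yes c<d = contradiction d≤c (ℕ.<⇒≱ c<d)
  ... | no _    = refl

  remainder-mono : ∀ x {r r′} → r ≤ r′ → remainder x r ≤ remainder x r′
  remainder-mono nothing  r≤r′ = r≤r′
  remainder-mono (just c) r≤r′ with c ℕ.<? d
  ... | yes _ = z≤n
  ... | no  _ = r≤r′

  remainder-≤ : ∀ x r → remainder x r ≤ r
  remainder-≤ nothing  r = ℕ.≤-refl
  remainder-≤ (just c) r with c ℕ.<? d
  ... | yes _ = z≤n
  ... | no  _ = ℕ.≤-refl

  odd>0 : ∀ {c} → Odd c → 0 < c
  odd>0 {zero}  od = contradiction (divides 0 refl) od
  odd>0 {suc _} _  = z<s

  digit>0 : ∀ c → 0 < digit (just c)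
  digit>0 c with c ℕ.<? d | even? c
  ... | yes _ | _     = z<s
  ... | no _  | yes _ = z<s
  ... | no _  | no _  = z<s

  digit<B : ∀ {x} → All (_≤ K) x → digit x < B
  digit<B {nothing} nothing = z<s
  digit<B {just c} (just c≤K) with c ℕ.<? d | even? c
  ... | yes _ | _     = s≤s (s≤s (ℕ.≤-trans (ℕ.m≤m+n K K) (ℕ.n≤1+n _)))
  ... | no _  | yes _ = s≤s (s≤s (s≤s (ℕ.+-monoʳ-≤ K c≤K)))
  ... | no _  | no _  = s≤s (s≤s (ℕ.≤-trans (ℕ.m∸n≤m K c) (ℕ.≤-trans (ℕ.m≤m+n K K) (ℕ.n≤1+n _))))

  digit-odd≤ : ∀ {c} → Odd c → digit (just c) ≤ suc K
  digit-odd≤ {c} od with c ℕ.<? d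
  ... | yes _ = ℕ.≤-refl
  ... | no _ with even? c
  ...   | yes ev = contradiction ev od
  ...   | no _   = s≤s (ℕ.m∸n≤m K c)

  -- If exactly one of the entries is below d, the other is the larger one if even and the smaller
  -- one if odd, since the order is reversed on odd colours. This is where the digits put them.
  digit-mono : ∀ {x y} → x ≼ y → x ≢ y → All (_≤ K) x → All (_≤ K) y →
    digit x < digit y ⊎ Any (_< d) x × Any (_< d) y
  digit-mono {y = nothing} blank x≢y _ _ = contradiction refl x≢y
  digit-mono {y = just c}  blank _   _ _ = inj₁ (digit>0 c)
  digit-mono {just c} {just b} c≼b c≢b (just c≤K) (just b≤K) = go c≼b (c ℕ.<? d) (b ℕ.<? d)
    where
    odd<small : Odd c → ¬ c < d → b < d → digit (just c) < digit (just b)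
    odd<small oc c≮d b<d rewrite digit-odd (ℕ.≮⇒≥ c≮d) oc | digit-small b<d =
      s≤s (ℕ.∸-monoʳ-< (odd>0 oc) c≤K)
    small<even : Even b → ¬ b < d → suc K < digit (just b)
    small<even eb b≮d rewrite digit-even (ℕ.≮⇒≥ b≮d) eb = s≤s (s≤s (ℕ.m≤m+n K b))
    go : just c ≼ just b → Dec (c < d) → Dec (b < d) →
         digit (just c) < digit (just b) ⊎ Any (_< d) (just c) × Any (_< d) (just b)
    go _ (yes c<d) (yes b<d) = inj₂ (just c<d , just b<d)
    go (odd-even oc eb)     _         (no b≮d)  = inj₁ (ℕ.≤-<-trans (digit-odd≤ oc) (small<even eb b≮d))
    go (odd-even oc eb)     (no c≮d)  (yes b<d) = inj₁ (odd<small oc c≮d b<d)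
    go (odd-odd oc ob b≤c)  (yes c<d) (no b≮d)  = contradiction (ℕ.≤-<-trans b≤c c<d) b≮d
    go (odd-odd oc ob b≤c)  (no c≮d)  (yes b<d) = inj₁ (odd<small oc c≮d b<d)
    go (odd-odd oc ob b≤c)  (no c≮d)  (no b≮d)
      rewrite digit-odd (ℕ.≮⇒≥ c≮d) oc | digit-odd (ℕ.≮⇒≥ b≮d) ob =
      inj₁ (s≤s (ℕ.∸-monoʳ-< (ℕ.≤∧≢⇒< b≤c λ { refl → c≢b refl }) c≤K))
    go (even-even ec eb c≤b) (yes c<d) (no b≮d) rewrite digit-small c<d = inj₁ (small<even eb b≮d)
    go (even-even ec eb c≤b) (no c≮d) (yes b<d) = contradiction (ℕ.≤-<-trans c≤b b<d) c≮d
    go (even-even ec eb c≤b) (no c≮d) (no b≮d)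
      rewrite digit-even (ℕ.≮⇒≥ c≮d) ec | digit-even (ℕ.≮⇒≥ b≮d) eb =
      inj₁ (s≤s (s≤s (ℕ.+-monoʳ-< K (ℕ.≤∧≢⇒< c≤b λ { refl → c≢b refl }))))

  leading-< : ∀ {a b r k} s → a < b → r < k → a * k + r < b * k + s
  leading-< {a} {b} {r} {k} s a<b r<k = begin-strict
    a * k + r  <⟨ ℕ.+-monoʳ-< (a * k) r<k ⟩
    a * k + k  ≡⟨ ℕ.+-comm (a * k) k ⟩
    suc a * k  ≤⟨ ℕ.*-monoˡ-≤ k a<b ⟩
    b * k      ≤⟨ ℕ.m≤m+n (b * k) s ⟩
    b * k + s  ∎
    where open ℕ.≤-Reasoning

  Φ<B^l : ∀ {l} {b : Seq l} → Bounded b → Φ b < B ^ l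
  Φ<B^l [] = z<s
  Φ<B^l {suc l} {x ∷ b} (p ∷ ps) = subst (Φ (x ∷ b) <_) (ℕ.+-identityʳ (B * B ^ l))
    (leading-< 0 (digit<B p) (ℕ.≤-<-trans (remainder-≤ x (Φ b)) (Φ<B^l ps)))

  -- The first differing entries decide the comparison, unless both are below d; then their digits
  -- agree and both remainders vanish.
  Φ-mono : ∀ {l} {b c : Seq l} → Bounded b → Bounded c → b ≤ₛ c → Φ b ≤ Φ c
  Φ-mono [] [] (base _) = z≤n
  Φ-mono {b = x ∷ b} {y ∷ c} (p ∷ ps) (q ∷ qs) (this (x≼y , x≢y) _) with digit-mono x≼y x≢y p q
  ... | inj₁ x<y = ℕ.<⇒≤ (leading-< _ x<y (ℕ.≤-<-trans (remainder-≤ x (Φ b)) (Φ<B^l ps)))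
  ... | inj₂ (just x<d , just y<d)
    rewrite digit-small x<d | digit-small y<d | remainder-small {r = Φ b} x<d | remainder-small {r = Φ c} y<d = ℕ.≤-refl
  Φ-mono {suc l} {x ∷ b} (p ∷ ps) (q ∷ qs) (next refl b≤c) =
    ℕ.+-monoʳ-≤ (digit x * B ^ l) (remainder-mono x (Φ-mono ps qs b≤c))

  Φ-blanks : ∀ l → Φ (blanks l) ≡ 0
  Φ-blanks zero    = refl
  Φ-blanks (suc l) = Φ-blanks l

  -- Rule II at the highest entry below c, or rule III if there is none.
  lower-step : ∀ {l c} (b : Seq l) → c < d → ∃ λ b′ → b ⟶[ c ] b′ × Φ b ≤ Φ b′
  lower-step []            _   = [] , stop , z≤n
  lower-step (nothing ∷ b) c<d with lower-step b c<d
  ... | b′ , s , le = nothing ∷ b′ , skip nothing s , le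
  lower-step {suc l} {c} (just x ∷ b) c<d with c ℕ.≤? x
  ... | no c≰x = _ , ruleII (just x<c) , small
    where
    x<c = ℕ.≰⇒> c≰x
    small : Φ (just x ∷ b) ≤ Φ (just c ∷ blanks l)
    small rewrite digit-small (ℕ.<-trans x<c c<d) | digit-small c<d
                | remainder-small {r = Φ b} (ℕ.<-trans x<c c<d) = ℕ.+-monoʳ-≤ (suc K * B ^ l) z≤n
  ... | yes c≤x with lower-step b c<d
  ...   | b′ , s , le = just x ∷ b′ , skip (just c≤x) s ,
    ℕ.+-monoʳ-≤ (digit (just x) * B ^ l) (remainder-mono (just x) le)

  -- If some entry is below d, rule II at the highest such entry raises its digit. Otherwise rule I
  -- applies at the lowest blank or odd entry; if there is none, all entries are even, as in a
  -- carry.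
  even-step : ∀ {l} (b : Seq l) → Even d → Bounded b →
    AllV (Any Even) b ⊎ ∃ λ b′ → b ⟶[ d ] b′ × Φ b < Φ b′
  even-step [] _ _ = inj₁ []
  even-step {suc l} (nothing ∷ b) ev (_ ∷ ps) with even-step b ev ps
  ... | inj₁ es = inj₂ (_ , ruleI es , leading-< {0} {digit (just d)} (remainder (just d) (Φ (blanks l))) (digit>0 d) (Φ<B^l ps))
  ... | inj₂ (b′ , s , lt) = inj₂ (nothing ∷ b′ , skip nothing s , lt)
  even-step {suc l} (just x ∷ b) ev (p ∷ ps) with d ℕ.≤? x
  ... | no d≰x = inj₂ (_ , ruleII (just x<d) , leading-< _ lt (ℕ.≤-<-trans (remainder-≤ (just x) (Φ b)) (Φ<B^l ps)))
    where
    x<d = ℕ.≰⇒> d≰x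
    lt : digit (just x) < digit (just d)
    lt rewrite digit-small x<d | digit-even ℕ.≤-refl ev = s≤s (s≤s (ℕ.m≤m+n K d))
  ... | yes d≤x with even-step b ev ps
  ...   | inj₁ es = by-parity (even? x)
    where
    odd<even : Odd x → digit (just x) < digit (just d)
    odd<even ox rewrite digit-even ℕ.≤-refl ev = ℕ.≤-<-trans (digit-odd≤ ox) (s≤s (s≤s (ℕ.m≤m+n K d)))
    by-parity : Dec (Even x) → AllV (Any Even) (just x ∷ b) ⊎ ∃ λ b′ → just x ∷ b ⟶[ d ] b′ × Φ (just x ∷ b) < Φ b′
    by-parity (yes ex) = inj₁ (just ex ∷ es)
    by-parity (no ox)  = inj₂ (_ , ruleI es ,
      leading-< _ (odd<even ox) (ℕ.≤-<-trans (remainder-≤ (just x) (Φ b)) (Φ<B^l ps)))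
  ...   | inj₂ (b′ , s , lt) = inj₂ (just x ∷ b′ , skip (just d≤x) s , keeps)
    where
    keeps : Φ (just x ∷ b) < Φ (just x ∷ b′)
    keeps rewrite remainder-large d≤x (Φ b) | remainder-large d≤x (Φ b′) =
      ℕ.+-monoʳ-< (digit (just x) * B ^ l) lt

-- Antagonistic updates

∈-sequencesOver⁺ : ∀ {xs l} {b : Seq l} → AllV (_∈ xs) b → b ∈ sequencesOver xs l
∈-sequencesOver⁺ []       = here refl
∈-sequencesOver⁺ (p ∷ ps) = ∈.∈-cartesianProductWith⁺ Vec._∷_ p (∈-sequencesOver⁺ ps)

∈-sequencesOver⁻ : ∀ {xs l} {b : Seq l} → b ∈ sequencesOver xs l → AllV (_∈ xs) b
∈-sequencesOver⁻ {l = zero}  {[]}    _  = []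
∈-sequencesOver⁻ {xs} {suc l} {x ∷ b} b∈ with ∈.∈-cartesianProductWith⁻ Vec._∷_ xs (sequencesOver xs l) b∈
... | _ , _ , x∈ , b∈′ , refl = x∈ ∷ ∈-sequencesOver⁻ b∈′

value-blanks : ∀ l → value (blanks l) ≡ 0
value-blanks zero    = refl
value-blanks (suc l) = trans (value-∷ nothing (blanks l)) (value-blanks l)

module Witnesses (G : ParityGame) where
  open ParityGame G
  open UpdateGames G
  open UpView G
  private
    module ⊑ = DecTotalOrder witnessOrder
    module Min = Extrema (DecTotalOrder.totalOrder witnessOrder)

  entries : List Entry
  entries = nothing ∷ List.map just colours

  valid? : ∀ (b : Seq len) → Dec (value b ≤ e × Decreasing b)
  valid? b = (value b ℕ.≤? e) ×-dec decreasing? b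

  ∈-𝕎⁺ : ∀ {b} → value b ≤ e → Decreasing b → AllV (_∈ entries) b → [ b ] ∈ 𝕎
  ∈-𝕎⁺ v≤e dec all = there (∈.∈-map⁺ [_] (∈.∈-filter⁺ valid? (∈-sequencesOver⁺ all) (v≤e , dec)))

  ∈-𝕎⁻ : ∀ {b} → [ b ] ∈ 𝕎 → Decreasing b × AllV (_∈ entries) b
  ∈-𝕎⁻ (there b∈) = go (∈.∈-map⁻ [_] b∈)
    where
    go : ∀ {b} → (∃ λ b′ → b′ ∈ filter valid? (sequencesOver entries len) × [ b ] ≡ [ b′ ]) →
         Decreasing b × AllV (_∈ entries) b
    go (b , b∈′ , refl) =
      let b∈″ , _ , dec = ∈.∈-filter⁻ valid? {xs = sequencesOver entries len} b∈′
      in dec , ∈-sequencesOver⁻ b∈″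

  blanks∈𝕎 : [ blanks len ] ∈ 𝕎
  blanks∈𝕎 = ∈-𝕎⁺ (subst (_≤ e) (sym (value-blanks len)) z≤n) (blanks-decreasing len)
                   (blanks-all (here refl))

  rawUpdate-all : ∀ {P : Entry → Set} {l} {b : Seq l} {d} → P nothing → P (just d) → AllV P b →
                  AllV P (rawUpdate b d)
  rawUpdate-all {P} {l} {b} {d} p₀ pd ps = go (rawUpdate-⟶ b d)
    where
    go : ∀ {c} → c ≡ blanks l ⊎ b ⟶[ d ] c → AllV P c
    go (inj₁ refl) = blanks-all p₀
    go (inj₂ s)    = ⟶-all p₀ pd s ps

  rawUpdate-decreasing : ∀ {l} {b : Seq l} {d} → Decreasing b → Decreasing (rawUpdate b d)
  rawUpdate-decreasing {l} {b} {d} dec = go (rawUpdate-⟶ b d)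
    where
    go : ∀ {c} → c ≡ blanks l ⊎ b ⟶[ d ] c → Decreasing c
    go (inj₁ refl) = blanks-decreasing l
    go (inj₂ s)    = ⟶-decreasing s dec

  up-∈𝕎 : ∀ {s} v → s ∈ 𝕎 → up s v ∈ 𝕎
  up-∈𝕎 {⊤⁺}    v _  = here refl
  up-∈𝕎 {[ b ]} v b∈ = go (up-view b v)
    where
    dec = proj₁ (∈-𝕎⁻ b∈)
    all = proj₂ (∈-𝕎⁻ b∈)
    go : ∀ {s} → UpView b v s → s ∈ 𝕎
    go (carried _)  = here refl
    go (overflow _) = here refl
    go (fits _ v≤e) = ∈-𝕎⁺ v≤e (rawUpdate-decreasing dec)
      (rawUpdate-all {b = b} (here refl) (there (∈.∈-map⁺ just (φ∈colours v))) all)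

  Improves : Witness → Vertex → Witness → Set
  Improves s v t = t ≡ ⊤⁺ ⊎ ∃ λ c → c ∈ 𝕎 × s ⊑ c × t ≡ up c v

  -- The minimum is attained or is the default `⊤⁺`. Lower bounds on `up` thus pass to `au`, since s
  -- is only replaced by a larger c before a basic update.
  au-cases : ∀ s v → Improves s v (au s v)
  au-cases s v = go (Min.argmin-sel id ⊤⁺ (List.map (λ c → up c v) (filter (s ⊑?_) 𝕎)))
    where
    go : ∀ {t} → t ≡ ⊤⁺ ⊎ t ∈ List.map (λ c → up c v) (filter (s ⊑?_) 𝕎) → Improves s v t
    go (inj₁ eq) = inj₁ eq
    go (inj₂ t∈) =
      let c , c∈ , eq = ∈.∈-map⁻ (λ c → up c v) t∈
          c∈𝕎 , s⊑c = ∈.∈-filter⁻ (s ⊑?_) {xs = 𝕎} c∈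
      in inj₂ (c , c∈𝕎 , s⊑c , eq)

  au-∈𝕎 : ∀ {s} v → s ∈ 𝕎 → au s v ∈ 𝕎
  au-∈𝕎 {s} v _ = go (au-cases s v)
    where
    go : ∀ {t} → Improves s v t → t ∈ 𝕎
    go (inj₁ refl)               = here refl
    go (inj₂ (c , c∈ , _ , refl)) = up-∈𝕎 v c∈

  au-won : ∀ v → au ⊤⁺ v ≡ ⊤⁺
  au-won v = go (au-cases ⊤⁺ v)
    where
    go : ∀ {t} → Improves ⊤⁺ v t → t ≡ ⊤⁺
    go (inj₁ eq)                = eq
    go (inj₂ (⊤⁺ , _ , _ , eq)) = eq

  -- Everything above t is also above s, so the minimum for t ranges over fewer values.
  au-mono : ∀ {s t} v → s ⊑ t → au s v ⊑ au t v
  au-mono {s} {t} v s⊑t = Min.min-mono-⊆ ⊑.refl λ x∈ →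
    let c , c∈ , eq = ∈.∈-map⁻ (λ c → up c v) x∈
        c∈𝕎 , t⊑c = ∈.∈-filter⁻ (t ⊑?_) {xs = 𝕎} c∈
    in subst (_∈ List.map (λ c → up c v) (filter (s ⊑?_) 𝕎)) (sym eq)
         (∈.∈-map⁺ (λ c → up c v) (∈.∈-filter⁺ (s ⊑?_) c∈𝕎 (⊑.trans s⊑t t⊑c)))

  au⊑up : ∀ {s} v → s ∈ 𝕎 → au s v ⊑ up s v
  au⊑up {s} v s∈ = LAll.lookup (Min.min≤xs ⊤⁺ (List.map (λ c → up c v) (filter (s ⊑?_) 𝕎)))
    (∈.∈-map⁺ (λ c → up c v) (∈.∈-filter⁺ (s ⊑?_) s∈ ⊑.refl))

  fold-au⊑fold-up : ∀ w {s t} → s ⊑ t → t ∈ 𝕎 → foldl au s w ⊑ foldl up t w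
  fold-au⊑fold-up []      s⊑t _  = s⊑t
  fold-au⊑fold-up (v ∷ w) s⊑t t∈ =
    fold-au⊑fold-up w (⊑.trans (au-mono v s⊑t) (au⊑up v t∈)) (up-∈𝕎 v t∈)

  won⊑⇒won : ∀ {s} → ⊤⁺ ⊑ s → s ≡ ⊤⁺
  won⊑⇒won (_ Supremum.≤⊤⁺) = refl

  antagonistic⇒basic : ∀ w → foldl au [ blanks len ] w ≡ ⊤⁺ → foldl up [ blanks len ] w ≡ ⊤⁺
  antagonistic⇒basic w eq =
    won⊑⇒won (subst (_⊑ foldl up [ blanks len ] w) eq (fold-au⊑fold-up w ⊑.refl blanks∈𝕎))

  -- The level orders on witnesses

  K : ℕ
  K = ℕ-Extrema.max 0 colours

  colour≤K : ∀ {c} → c ∈ colours → c ≤ K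
  colour≤K = LAll.lookup (ℕ-Extrema.xs≤max 0 colours)

  entries≤K : ∀ {x} → x ∈ entries → All (_≤ K) x
  entries≤K (here refl) = nothing
  entries≤K (there x∈) with ∈.∈-map⁻ just x∈
  ... | c , c∈ , refl = just (colour≤K c∈)

  module _ (d : ℕ) where
    open Potential K d

    Φ⁺ : Witness → ℕ
    Φ⁺ ⊤⁺    = B ^ len
    Φ⁺ [ b ] = Φ b

    bounded : ∀ {b} → [ b ] ∈ 𝕎 → Bounded b
    bounded b∈ = VAll.map entries≤K (proj₂ (∈-𝕎⁻ b∈))

    Φ⁺-mono : ∀ {s t} → s ∈ 𝕎 → t ∈ 𝕎 → s ⊑ t → Φ⁺ s ≤ Φ⁺ t
    Φ⁺-mono s∈ t∈ Supremum.[ b≤c ] = Φ-mono (bounded s∈) (bounded t∈) b≤c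
    Φ⁺-mono {⊤⁺}    s∈ t∈ (_ Supremum.≤⊤⁺) = ℕ.≤-refl
    Φ⁺-mono {[ b ]} s∈ t∈ (_ Supremum.≤⊤⁺) = ℕ.<⇒≤ (Φ<B^l (bounded s∈))

    Φ⁺-full : ∀ {s} → s ∈ 𝕎 → B ^ len ≤ Φ⁺ s → s ≡ ⊤⁺
    Φ⁺-full {⊤⁺}    _  _    = refl
    Φ⁺-full {[ b ]} s∈ full = contradiction full (ℕ.<⇒≱ (Φ<B^l (bounded s∈)))

    -- The raw update is the largest result of a rule, so one well-chosen result bounds its code
    -- from below.
    Φ-rawUpdate : ∀ {b v b′} → [ b ] ∈ 𝕎 → b ⟶[ φ v ] b′ → Φ b′ ≤ Φ (rawUpdate b (φ v))
    Φ-rawUpdate {b} {v} b∈ s = Φ-mono (⟶-all nothing v≤K s (bounded b∈))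
      (rawUpdate-all {b = b} nothing v≤K (bounded b∈)) (⟶-≤-rawUpdate b (φ v) s)
      where v≤K = just (colour≤K (φ∈colours v))

    Φ-up : ∀ {b v b′ s} → [ b ] ∈ 𝕎 → b ⟶[ φ v ] b′ → UpView b v s → Φ b′ ≤ Φ⁺ s
    Φ-up {v = v} b∈ s (carried _)  = ℕ.<⇒≤ (Φ<B^l (⟶-all nothing (just (colour≤K (φ∈colours v))) s (bounded b∈)))
    Φ-up {v = v} b∈ s (overflow _) = ℕ.<⇒≤ (Φ<B^l (⟶-all nothing (just (colour≤K (φ∈colours v))) s (bounded b∈)))
    Φ-up b∈ s (fits _ _)   = Φ-rawUpdate b∈ s

    Φ⁺-up-mono : ∀ {s} v → s ∈ 𝕎 → φ v < d → Φ⁺ s ≤ Φ⁺ (up s v)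
    Φ⁺-up-mono {⊤⁺}    v _  _   = ℕ.≤-refl
    Φ⁺-up-mono {[ b ]} v b∈ v<d =
      let b′ , s , le = lower-step b v<d in ℕ.≤-trans le (Φ-up b∈ s (up-view b v))

    Φ⁺-up-inc : ∀ {s} v → s ∈ 𝕎 → Even d → φ v ≡ d → s ≡ ⊤⁺ ⊎ Φ⁺ s < Φ⁺ (up s v)
    Φ⁺-up-inc {⊤⁺}    v _  _  _    = inj₁ refl
    Φ⁺-up-inc {[ b ]} v b∈ ev refl = inj₂ (go (even-step b ev (bounded b∈)) (up-view b v))
      where
      go : AllV (Any Even) b ⊎ (∃ λ b′ → b ⟶[ d ] b′ × Φ b < Φ b′) →
           ∀ {s} → UpView b v s → Φ b < Φ⁺ s
      go (inj₂ (b′ , s , lt)) u            = ℕ.<-≤-trans lt (Φ-up b∈ s u)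
      go (inj₁ evens)         (carried _)  = Φ<B^l (bounded b∈)
      go (inj₁ evens)         (overflow _) = Φ<B^l (bounded b∈)
      -- All entries and d are even, which is a carry, so the update cannot be a sequence.
      go (inj₁ evens)         (fits ¬c _)  = contradiction (ev , at-all⁺ evens) ¬c

    Φ⁺-au-mono : ∀ {s} v → s ∈ 𝕎 → φ v < d → Φ⁺ s ≤ Φ⁺ (au s v)
    Φ⁺-au-mono {s} v s∈ v<d = go (au-cases s v)
      where
      go : ∀ {t} → Improves s v t → Φ⁺ s ≤ Φ⁺ t
      go (inj₁ refl) = Φ⁺-mono s∈ (here refl) (_ Supremum.≤⊤⁺)
      go (inj₂ (c , c∈ , s⊑c , refl)) = ℕ.≤-trans (Φ⁺-mono s∈ c∈ s⊑c) (Φ⁺-up-mono v c∈ v<d)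

    Φ⁺-au-inc : ∀ {s} v → s ∈ 𝕎 → Even d → φ v ≡ d → s ≡ ⊤⁺ ⊎ Φ⁺ s < Φ⁺ (au s v)
    Φ⁺-au-inc {⊤⁺}    v _  _  _  = inj₁ refl
    Φ⁺-au-inc {[ b ]} v b∈ ev eq = inj₂ (go (au-cases [ b ] v))
      where
      go : ∀ {t} → Improves [ b ] v t → Φ b < Φ⁺ t
      go (inj₁ refl) = Φ<B^l (bounded b∈)
      go (inj₂ (c , c∈ , b⊑c , refl)) = beyond (Φ⁺-up-inc v c∈ ev eq)
        where
        beyond : c ≡ ⊤⁺ ⊎ Φ⁺ c < Φ⁺ (up c v) → Φ b < Φ⁺ (up c v)
        beyond (inj₁ refl) = Φ<B^l (bounded b∈)
        beyond (inj₂ lt)   = ℕ.≤-<-trans (Φ⁺-mono b∈ c∈ b⊑c) lt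

  module _ (R : Vertex → Vertex → Set) (even-cycles : ∀ {c x} → Walk φ R c x x → Even c) where

    long-words-win : ∃ λ L → ∀ {w} → Linked R w → L ≤ length w → foldl au [ blanks len ] w ≡ ⊤⁺
    -- The bound `suc K` exceeds every colour, so it covers all words.
    long-words-win = go (forced (suc K))
      where
      open LongWords φ R even-cycles au ⊤⁺ (_∈ 𝕎) au-won au-∈𝕎 ((3 + K + K) ^ len) Φ⁺
        Φ⁺-full Φ⁺-au-mono Φ⁺-au-inc
      go : ∃ (Forced (suc K)) → ∃ λ L → ∀ {w} → Linked R w → L ≤ length w →
           foldl au [ blanks len ] w ≡ ⊤⁺
      go (L , win) = L , λ l long → win blanks∈𝕎 l (LAll.universal (λ v → s≤s (colour≤K (φ∈colours v))) _) long

-- Strategies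

walk-map : ∀ {A : Set} {φ : A → ℕ} {R S : A → A → Set} → (∀ {x y} → R x y → S x y) →
           ∀ {c x y} → Walk φ R c x y → Walk φ S c x y
walk-map f [ r ]   = [ f r ]
walk-map f (r ∷ w) = f r ∷ walk-map f w

linked-reverse : ∀ {A : Set} {R : A → A → Set} {xs} → Linked R xs → Linked (flip R) (reverse xs)
linked-reverse {A} {R} {[]}     _ = []
linked-reverse {A} {R} {x ∷ xs} l = go l [-]
  where
  go : ∀ {x xs acc} → Linked R (x ∷ xs) → Linked (flip R) (x ∷ acc) →
       Linked (flip R) (xs ʳ++ (x ∷ acc))
  go [-]     l′ = l′
  go (r ∷ l) l′ = go l (r ∷ l′)

module Equivalence (G : ParityGame) where
  open ParityGame G
  open ParityGameSemantics G
  open UpdateGames G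
  open Determinacy G
  open Solution determinacy
  open Witnesses G

  Region : Player → Vertex → Vertex → Set
  Region p x y = Step x y × winner x ≡ p

  region-cycles : ∀ {p c x} → Walk φ (Region p) c x x → parityOf c ≡ p
  region-cycles w = trans (cycles (walk-map proj₁ w)) (source w)
    where
    source : ∀ {p c x y} → Walk φ (Region p) c x y → winner x ≡ p
    source [ _ , eq ]     = eq
    source ((_ , eq) ∷ _) = eq

  Follows : Player → Play → Set
  Follows p ρ = ∀ i → owner (ρ i) ≡ p → ρ (suc i) ≡ proj₁ (move (ρ i))

  play-in-region : ∀ {p v ρ} → winner v ≡ p → IsPlayFrom v ρ → Follows p ρ →
                   ∀ i → Region p (ρ i) (ρ (suc i))
  play-in-region {p} {v} {ρ} v∈p (start , edges) follows i = step i (inside i) , inside i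
    where
    step : ∀ i → winner (ρ i) ≡ p → Step (ρ i) (ρ (suc i))
    step i eq = Sub.∈⊤ , edges i , λ own → follows i (trans own eq)
    inside : ∀ i → winner (ρ i) ≡ p
    inside zero    = trans (cong winner start) v∈p
    inside (suc i) = trans (closed (step i (inside i))) (inside i)

  word : Direction → List Vertex → List Vertex
  word forward  = id
  word backward = reverse

  orient : Direction → (Vertex → Vertex → Set) → Vertex → Vertex → Set
  orient forward  R = R
  orient backward R = flip R

  evaluate-word : ∀ dir k vs → evaluate dir k vs ≡ foldl (update k) [ blanks len ] (word dir vs)
  evaluate-word forward  k vs = refl
  evaluate-word backward k vs = sym (List.reverse-foldl (update k) [ blanks len ] vs)

  oriented-prefix : ∀ dir {R} {ρ : Play} → (∀ i → R (ρ i) (ρ (suc i))) → ∀ m →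
                    Linked (orient dir R) (word dir (prefix ρ m))
  oriented-prefix forward  {ρ = ρ} steps m = Linked.applyUpTo⁺₂ ρ (suc m) steps
  oriented-prefix backward {ρ = ρ} steps m = linked-reverse (Linked.applyUpTo⁺₂ ρ (suc m) steps)

  oriented-cycles : ∀ dir {R} {c x} → Walk φ (orient dir R) c x x → Walk φ R c x x
  oriented-cycles forward  w = w
  oriented-cycles backward w = walk-reverse w

  length-word : ∀ dir vs → length (word dir vs) ≡ length vs
  length-word forward  vs = refl
  length-word backward vs = List.length-reverse vs

  -- Winning by antagonistic updates implies winning by basic ones. Hence wins are established for
  -- `au`, and impossibility is derived from `up`.
  weaken : ∀ k w → foldl au [ blanks len ] w ≡ ⊤⁺ → foldl (update k) [ blanks len ] w ≡ ⊤⁺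
  weaken basic         w = antagonistic⇒basic w
  weaken antagonistic  w = id

  strengthen : ∀ k w → foldl (update k) [ blanks len ] w ≡ ⊤⁺ → foldl up [ blanks len ] w ≡ ⊤⁺
  strengthen basic        w = id
  strengthen antagonistic w = antagonistic⇒basic w

  positional : MoveStrategy
  positional _ v _ = move v

  -- The limit superior of a play in even's region is the largest colour of a cycle there, hence
  -- even.
  wins-parity : ∀ {v} → winner v ≡ even → WinsParityGame v
  wins-parity v∈W = positional , λ ρ play consistent lost →
    let steps = play-in-region v∈W play consistent in
    limsup-exists K (0 , λ i _ → colour≤K (φ∈colours (ρ i))) λ (c , lim) →
    limsup-cycle ρ steps lim λ (i , w) →
    lost (c , lim , parityOf⇒Even (region-cycles w))

  wins-update : ∀ dir k {v} → winner v ≡ even → WinsUpdateGame dir k v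
  wins-update dir k v∈W = positional , halt , λ ρ play consistent →
      L , stops ρ , trans (evaluate-word dir k (prefix ρ L)) (weaken k (word dir (prefix ρ L))
        (win (oriented-prefix dir (play-in-region v∈W play consistent) L) (long ρ)))
    where
    bound = long-words-win (orient dir (Region even))
              (λ w → parityOf⇒Even (region-cycles (oriented-cycles dir w)))
    L = proj₁ bound
    win = proj₂ bound
    halt : StopStrategy
    -- Stopping at index L means that `suc L` vertices have been read, at least the L that force a
    -- win.
    halt vs = does (length vs ℕ.≟ suc L)
    stops : ∀ ρ → StopsAt halt ρ L
    stops ρ = dec-true (_ ℕ.≟ _) (List.length-applyUpTo ρ (suc L))
            , λ i i<L → dec-false (_ ℕ.≟ _) λ eq →
                ℕ.<⇒≢ i<L (ℕ.suc-injective (trans (sym (List.length-applyUpTo ρ (suc i))) eq))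
    long : ∀ ρ → L ≤ length (word dir (prefix ρ L))
    long ρ = subst (L ≤_) (sym (trans (length-word dir (prefix ρ L)) (List.length-applyUpTo ρ (suc L))))
                   (ℕ.n≤1+n L)

  -- The play in which even uses σ and odd the determinacy strategy.
  module Against (σ : MoveStrategy) (v : Vertex) where

    reply : ∀ p (h : List Vertex) u → owner u ≡ p → ∃ (Edge u)
    reply even h u o = σ h u o
    reply odd  h u _ = move u

    position : ℕ → List Vertex × Vertex
    position zero    = [] , v
    position (suc i) = let h , u = position i in h ∷ʳ u , proj₁ (reply (owner u) h u refl)

    ρ : Play
    ρ i = proj₂ (position i)

    history : ∀ i → proj₁ (position i) ≡ applyUpTo ρ i
    history zero    = refl
    history (suc i) = trans (cong (_∷ʳ ρ i) (history i)) (List.applyUpTo-∷ʳ ρ i)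

    is-play : IsPlayFrom v ρ
    is-play = refl , λ i → proj₂ (reply (owner (ρ i)) (proj₁ (position i)) (ρ i) refl)

    -- A strategy takes a proof of ownership as argument; such proofs are equal because equality of
    -- players is decidable.
    reply-even : ∀ p h u (q : owner u ≡ p) (o : owner u ≡ even) → reply p h u q ≡ σ h u o
    reply-even even h u q o = cong (σ h u) (Decidable⇒UIP.≡-irrelevant _≟ₚ_ q o)
    reply-even odd  h u q o with () ← trans (sym q) o

    reply-odd : ∀ p h u (q : owner u ≡ p) → owner u ≡ odd → reply p h u q ≡ move u
    reply-odd even h u q o with () ← trans (sym q) o
    reply-odd odd  h u q o = refl

    consistent : Consistent σ ρ
    consistent i o = cong proj₁ (trans (reply-even _ (proj₁ (position i)) (ρ i) refl o)
                                       (cong (λ h → σ h (ρ i) o) (history i)))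

    follows : Follows odd ρ
    follows i o = cong proj₁ (reply-odd _ (proj₁ (position i)) (ρ i) refl o)

  no-even-cycle : ∀ {c x} → Walk φ (Region odd) c x x → ¬ Even c
  no-even-cycle w ev with () ← trans (sym (Even⇒parityOf ev)) (region-cycles w)

  loses-parity : ∀ {v} → winner v ≡ odd → ¬ WinsParityGame v
  loses-parity {v} v∈W (σ , wins) = wins ρ is-play consistent λ (c , lim , ev) →
      limsup-cycle ρ (play-in-region v∈W is-play follows) lim λ (i , w) → no-even-cycle w ev
    where open Against σ v

  loses-update : ∀ dir k {v} → winner v ≡ odd → ¬ WinsUpdateGame dir k v
  loses-update dir k {v} v∈W (σ , τ , wins) =
    let m , _ , won = wins ρ is-play consistent
        w = word dir (prefix ρ m)
        _ , _ , ev , cycle = Soundness.won⇒even-cycle G (orient dir (Region odd))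
          (oriented-prefix dir (play-in-region v∈W is-play follows) m)
          (strengthen k w (trans (sym (evaluate-word dir k (prefix ρ m))) won))
    in no-even-cycle (oriented-cycles dir cycle) ev
    where open Against σ v

  -- No strategy is translated between the games: `winner v` decides both of them.
  equivalence : ∀ dir k v → WinsUpdateGame dir k v ⇔ WinsParityGame v
  equivalence dir k v = by-winner (winner v) refl
    where
    by-winner : ∀ p → winner v ≡ p → WinsUpdateGame dir k v ⇔ WinsParityGame v
    by-winner even eq = mk⇔ (λ _ → wins-parity eq) (λ _ → wins-update dir k eq)
    by-winner odd  eq = mk⇔ (λ w → contradiction w (loses-update dir k eq))
                            (λ w → contradiction w (loses-parity eq))

corollary1 :
    (G : ParityGame) (v : ParityGame.Vertex G) →
    let open ParityGameSemantics G
        open UpdateGames G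
    in (WinsUpdateGame forward  basic        v ⇔ WinsParityGame v)
     × (WinsUpdateGame backward basic        v ⇔ WinsParityGame v)
     × (WinsUpdateGame forward  antagonistic v ⇔ WinsParityGame v)
     × (WinsUpdateGame backward antagonistic v ⇔ WinsParityGame v)
corollary1 G v =
    equivalence forward  basic        v
  , equivalence backward basic        v
  , equivalence forward  antagonistic v
  , equivalence backward antagonistic v
  where open Equivalence G
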